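{- The $\tilde{\mathcal L}$-theory $T$ described below is complete.
   Context: Let $\mathcal L_0=\{P_i: i\in\omega\}\cup\{<_i:i\in\omega\}$ with $P_i$ unary and $<_i$ binary relation symbols. $T_0$ is the $\mathcal L_0$-theory with axioms: for all $i\neq j$, $P_i\cap P_j=\emptyset$; for all $i$: $<_i\subseteq P_i\times P_{i+1}$; $\forall x\in P_{i+1}\,\exists y\in P_i\,(y<_i x)$; $\forall x\forall x'\forall y((x<_i y\wedge x'<_i y)\to x=x')$. Let $(\mathcal M_i)_{i<\omega}$ list without repetition representatives of all isomorphism types of finite models of $T_0$. For $i,j\in\omega$ let $C_i^j$ be a set of $|M_i|$ new constant symbols (these sets pairwise disjoint), with a fixed bijection $e_i^j:C_i^j\to M_i$; let $C=\bigcup_{i,j}C_i^j$ and $\tilde{\mathcal L}=\mathcal L_0\cup C$. $T$ consists of: $T_0$; $c\neq d$ for distinct $c,d\in C$; for each $i,j$ the atomic and negated atomic $\mathcal L_0$-sentences making the substructure on $C_i^j$ isomorphic to $\mathcal M_i$ via $e_i^j$; and for each $i,j,k$: $\forall x\forall y\big((\bigvee_{c\in C_i^j}x=c)\wedge(x<_k y\vee y<_k x)\to\bigvee_{c\in C_i^j}y=c\big)$. -}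

module Defs where

open import Data.Nat using (ℕ; zero; suc; _≤_)
open import Data.Fin using (Fin; zero; suc)
open import Data.Bool using (Bool; true; false)
open import Data.Empty using (⊥)
open import Data.Product using (Σ; _×_; _,_)
open import Data.Sum using (_⊎_)
open import Relation.Binary.PropositionalEquality using (_≡_; _≢_)
open import Relation.Nullary using (¬_)
open import Function.Bundles using (_↔_; Inverse)

-- First-order syntax for the signature  {P_i , <_i : i ∈ ω}  with equality,
-- extended by a set C of constant symbols.  Formulas are in de Bruijn
-- form: Fm C k = formulas with (at most) k free variables; sentences
-- are Fm C 0.  Primitive connectives: ⊥, ⇒, ∀, everything else defined.

data Tm (C : Set) (k : ℕ) : Set where
  var : Fin k → Tm C k
  con : C → Tm C k

data Fm (C : Set) (k : ℕ) : Set where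
  P    : ℕ → Tm C k → Fm C k
  R    : ℕ → Tm C k → Tm C k → Fm C k     -- R i s t  means  s <_i t
  _≐_  : Tm C k → Tm C k → Fm C k
  ⊥'   : Fm C k
  _⇒_  : Fm C k → Fm C k → Fm C k
  ∀'   : Fm C (suc k) → Fm C k

infix  7 _≐_
infixr 5 _⇒_

module _ {C : Set} where

  ¬' : ∀ {k} → Fm C k → Fm C k
  ¬' φ = φ ⇒ ⊥'

  _∨'_ : ∀ {k} → Fm C k → Fm C k → Fm C k
  φ ∨' ψ = ¬' φ ⇒ ψ

  _∧'_ : ∀ {k} → Fm C k → Fm C k → Fm C k
  φ ∧' ψ = ¬' (φ ⇒ ¬' ψ)

  ∃' : ∀ {k} → Fm C (suc k) → Fm C k
  ∃' φ = ¬' (∀' (¬' φ))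

  ⋁ : ∀ {k} (n : ℕ) → (Fin n → Fm C k) → Fm C k
  ⋁ zero    f = ⊥'
  ⋁ (suc n) f = f zero ∨' ⋁ n (λ x → f (suc x))

  extR : ∀ {k l} → (Fin k → Fin l) → Fin (suc k) → Fin (suc l)
  extR ρ zero    = zero
  extR ρ (suc x) = suc (ρ x)

  renT : ∀ {k l} → (Fin k → Fin l) → Tm C k → Tm C l
  renT ρ (var x) = var (ρ x)
  renT ρ (con c) = con c

  renF : ∀ {k l} → (Fin k → Fin l) → Fm C k → Fm C l
  renF ρ (P i t)   = P i (renT ρ t)
  renF ρ (R i s t) = R i (renT ρ s) (renT ρ t)
  renF ρ (s ≐ t)   = renT ρ s ≐ renT ρ t
  renF ρ ⊥'        = ⊥'
  renF ρ (φ ⇒ ψ)   = renF ρ φ ⇒ renF ρ ψ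
  renF ρ (∀' φ)    = ∀' (renF (extR ρ) φ)

  extS : ∀ {k l} → (Fin k → Tm C l) → Fin (suc k) → Tm C (suc l)
  extS σ zero    = var zero
  extS σ (suc x) = renT suc (σ x)

  subT : ∀ {k l} → (Fin k → Tm C l) → Tm C k → Tm C l
  subT σ (var x) = σ x
  subT σ (con c) = con c

  subF : ∀ {k l} → (Fin k → Tm C l) → Fm C k → Fm C l
  subF σ (P i t)   = P i (subT σ t)
  subF σ (R i s t) = R i (subT σ s) (subT σ t)
  subF σ (s ≐ t)   = subT σ s ≐ subT σ t
  subF σ ⊥'        = ⊥'
  subF σ (φ ⇒ ψ)   = subF σ φ ⇒ subF σ ψ
  subF σ (∀' φ)    = ∀' (subF (extS σ) φ)

  inst : ∀ {k} → Fm C (suc k) → Tm C k → Fm C k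
  inst {k} φ t = subF σ φ
    where
    σ : Fin (suc k) → Tm C k
    σ zero    = t
    σ (suc x) = var x

  wk : ∀ {k} → Fm C k → Fm C (suc k)
  wk = renF suc

  close : ∀ {k} → Fm C 0 → Fm C k
  close = renF (λ ())

-- A standard sound and complete Hilbert calculus for classical
-- first-order logic with equality.  Der Γ k φ : φ (with k free
-- variables) is derivable from the set Γ of sentences.

data Der {C : Set} (Γ : Fm C 0 → Set) : (k : ℕ) → Fm C k → Set where
  ax   : ∀ {k σ} → Γ σ → Der Γ k (close σ)
  mp   : ∀ {k φ ψ} → Der Γ k (φ ⇒ ψ) → Der Γ k φ → Der Γ k ψ
  gen  : ∀ {k φ} → Der Γ (suc k) φ → Der Γ k (∀' φ)
  ax-K : ∀ {k} (φ ψ : Fm C k) → Der Γ k (φ ⇒ ψ ⇒ φ)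
  ax-S : ∀ {k} (φ ψ χ : Fm C k) →
         Der Γ k ((φ ⇒ ψ ⇒ χ) ⇒ (φ ⇒ ψ) ⇒ φ ⇒ χ)
  ax-DN : ∀ {k} (φ : Fm C k) → Der Γ k (¬' (¬' φ) ⇒ φ)
  ax-inst : ∀ {k} (φ : Fm C (suc k)) (t : Tm C k) → Der Γ k (∀' φ ⇒ inst φ t)
  ax-dist : ∀ {k} (φ ψ : Fm C (suc k)) → Der Γ k (∀' (φ ⇒ ψ) ⇒ ∀' φ ⇒ ∀' ψ)
  ax-vac  : ∀ {k} (φ : Fm C k) → Der Γ k (φ ⇒ ∀' (wk φ))
  ax-refl : ∀ {k} (t : Tm C k) → Der Γ k (t ≐ t)
  ax-leib : ∀ {k} (φ : Fm C (suc k)) (s t : Tm C k) →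
            Der Γ k (s ≐ t ⇒ inst φ s ⇒ inst φ t)

_⊢_ : {C : Set} → (Fm C 0 → Set) → Fm C 0 → Set
Γ ⊢ φ = Der Γ 0 φ

Complete : {C : Set} → (Fm C 0 → Set) → Set
Complete {C} Γ = ¬ (Γ ⊢ ⊥') × ((φ : Fm C 0) → (Γ ⊢ φ) ⊎ (Γ ⊢ ¬' φ))

x₀ : ∀ {C k} → Tm C (suc k)
x₀ = var zero
x₁ : ∀ {C k} → Tm C (suc (suc k))
x₁ = var (suc zero)
x₂ : ∀ {C k} → Tm C (suc (suc (suc k)))
x₂ = var (suc (suc zero))

data T₀ {C : Set} : Fm C 0 → Set where
  disj : (i j : ℕ) → i ≢ j → T₀ (∀' (¬' (P i x₀ ∧' P j x₀)))
  typ  : (i : ℕ) → T₀ (∀' (∀' (R i x₁ x₀ ⇒ (P i x₁ ∧' P (suc i) x₀))))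
  pred : (i : ℕ) → T₀ (∀' (P (suc i) x₀ ⇒ ∃' (P i x₀ ∧' R i x₀ x₁)))
  uniq : (i : ℕ) → T₀ (∀' (∀' (∀' ((R i x₂ x₀ ∧' R i x₁ x₀) ⇒ x₂ ≐ x₁))))

record Structure (C : Set) : Set₁ where
  field
    Dom : Set
    Pᴹ  : ℕ → Dom → Set
    Rᴹ  : ℕ → Dom → Dom → Set
    cᴹ  : C → Dom

module _ {C : Set} (M : Structure C) where
  open Structure M

  evalT : ∀ {k} → Tm C k → (Fin k → Dom) → Dom
  evalT (var x) ρ = ρ x
  evalT (con c) ρ = cᴹ c

  cons : ∀ {k} → Dom → (Fin k → Dom) → Fin (suc k) → Dom
  cons a ρ zero    = a
  cons a ρ (suc x) = ρ x

  Sat : ∀ {k} → Fm C k → (Fin k → Dom) → Set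
  Sat (P i t)   ρ = Pᴹ i (evalT t ρ)
  Sat (R i s t) ρ = Rᴹ i (evalT s ρ) (evalT t ρ)
  Sat (s ≐ t)   ρ = evalT s ρ ≡ evalT t ρ
  Sat ⊥'        ρ = ⊥
  Sat (φ ⇒ ψ)   ρ = Sat φ ρ → Sat ψ ρ
  Sat (∀' φ)    ρ = (a : Dom) → Sat φ (cons a ρ)

  _⊨_ : Fm C 0 → Set
  _⊨_ φ = Sat φ (λ ())

record FinStr (n : ℕ) : Set where
  field
    Pb : ℕ → Fin n → Bool
    Rb : ℕ → Fin n → Fin n → Bool     -- Rb i a b = true  iff  a <_i b
open FinStr public

asStructure : ∀ {n} → FinStr n → Structure ⊥
asStructure {n} A = record
  { Dom = Fin n
  ; Pᴹ  = λ i a → Pb A i a ≡ true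
  ; Rᴹ  = λ i a b → Rb A i a b ≡ true
  ; cᴹ  = λ () }

IsModelT₀ : ∀ {n} → FinStr n → Set
IsModelT₀ A = (σ : Fm ⊥ 0) → T₀ σ → asStructure A ⊨ σ

Iso : ∀ {n m} → FinStr n → FinStr m → Set
Iso {n} {m} A B =
  Σ (Fin n ↔ Fin m) λ f →
    ((i : ℕ) (a : Fin n) → Pb B i (Inverse.to f a) ≡ Pb A i a) ×
    ((i : ℕ) (a b : Fin n) → Rb B i (Inverse.to f a) (Inverse.to f b) ≡ Rb A i a b)

record Enumeration : Set where
  field
    size     : ℕ → ℕ
    str      : (i : ℕ) → FinStr (size i)
    nonempty : (i : ℕ) → 1 ≤ size i
    model    : (i : ℕ) → IsModelT₀ (str i)
    norep    : (i j : ℕ) → Iso (str i) (str j) → i ≡ j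
    complete : (n : ℕ) → 1 ≤ n → (A : FinStr n) → IsModelT₀ A →
               Σ ℕ λ i → Iso A (str i)
open Enumeration public

-- The language L̃ = L₀ ∪ C.  The constant (i , j , a) is the element of
-- C_i^j with e_i^j(i , j , a) = a ∈ M_i.

Const : Enumeration → Set
Const E = Σ ℕ λ i → ℕ × Fin (size E i)

module _ (E : Enumeration) where

  cst : ∀ {k} (i j : ℕ) → Fin (size E i) → Tm (Const E) k
  cst i j a = con (i , j , a)

  closureAx : (i j k : ℕ) → Fm (Const E) 0
  closureAx i j k =
    ∀' (∀' ((⋁ (size E i) (λ a → x₁ ≐ cst i j a)
              ∧' (R k x₁ x₀ ∨' R k x₀ x₁))
            ⇒ ⋁ (size E i) (λ a → x₀ ≐ cst i j a)))

  data T : Fm (Const E) 0 → Set where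
    ax₀   : ∀ {σ} → T₀ σ → T σ
    dist  : (c d : Const E) → c ≢ d → T (¬' (con c ≐ con d))
    -- atomic diagram of M_i on C_i^j via e_i^j
    eq⁺   : (i j : ℕ) (a b : Fin (size E i)) → a ≡ b → T (cst i j a ≐ cst i j b)
    eq⁻   : (i j : ℕ) (a b : Fin (size E i)) → a ≢ b → T (¬' (cst i j a ≐ cst i j b))
    P⁺    : (i j k : ℕ) (a : Fin (size E i)) → Pb (str E i) k a ≡ true →
            T (P k (cst i j a))
    P⁻    : (i j k : ℕ) (a : Fin (size E i)) → Pb (str E i) k a ≡ false →
            T (¬' (P k (cst i j a)))
    R⁺    : (i j k : ℕ) (a b : Fin (size E i)) → Rb (str E i) k a b ≡ true →
            T (R k (cst i j a) (cst i j b))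
    R⁻    : (i j k : ℕ) (a b : Fin (size E i)) → Rb (str E i) k a b ≡ false →
            T (¬' (R k (cst i j a) (cst i j b)))
    clos  : (i j k : ℕ) → T (closureAx i j k)

{-# OPTIONS --safe #-}
module Submission where

open import Defs
open import Data.Bool using (true; false)
import Data.Bool.Properties as Bool
open import Data.Empty using (⊥; ⊥-elim)
open import Data.Fin using (Fin; zero; suc; toℕ; fromℕ<; finToFun; funToFin; combine)
import Data.Fin.Properties as Fin
open import Data.List using (List; []; _++_; concatMap; map; allFin; upTo; length; lookup)
import Data.List as List
open import Data.List.Membership.Propositional using (_∈_)
open import Data.List.Membership.Propositional.Properties
  using (∈-map⁺; ∈-map⁻; ∈-++⁺ˡ; ∈-++⁺ʳ; ∈-concatMap⁺; ∈-concatMap⁻; ∈-allFin; ∈-lookup; ∈-upTo⁺)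
open import Data.List.Relation.Unary.Any using (here; there)
import Data.List.Relation.Unary.Any as Any
open import Data.List.Relation.Unary.Any.Properties using (lookup-index; ++⁺ˡ)
open import Data.Maybe using (Maybe; just; nothing)
import Data.Maybe.Properties as Maybe
open import Data.Nat using (ℕ; zero; suc; _≤_; _<_; _+_; _∸_; _^_; _⊔_; z≤n; s≤s; _≟_; _<?_)
open import Data.Nat.Properties hiding (_≟_; _<?_)
open import Data.Product using (Σ; _×_; _,_; proj₁; proj₂; ∃; swap)
open import Data.Product.Function.Dependent.Propositional using (Σ-↔)
import Data.Product.Properties as Product
open import Data.Sum using (_⊎_; inj₁; inj₂)
open import Data.Sum.Function.Propositional using (_⊎-↔_)
open import Data.Unit using (⊤; tt)
open import Data.Vec.Functional using (_∷_)
open import Function using (_∘_; id)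
open import Function.Bundles using (_↔_; Inverse; mk↔ₛ′)
open import Function.Properties.Inverse using (↔-refl; ↔-sym; ↔-trans)
open import Relation.Binary.Definitions using (tri<; tri≈; tri>)
open import Relation.Binary.PropositionalEquality
open import Relation.Nullary using (Dec; yes; no; does; ¬_)
open import Relation.Nullary.Decidable
  using (map′; _×-dec_; dec-true; dec-false; decidable-stable)

-- The calculus is complete for exploding models, in which falsity is
-- interpreted by an arbitrary set B: Krivine's form of Henkin's theorem, which
-- is constructive.  In such a model classical arguments about goals implying B
-- are available, and an Ehrenfeucht–Fraïssé game can be played.  Up to level N
-- a model of T is a forest; a node is described by the number of its children
-- of each type, truncated at K.  All the finitely many types occur in one
-- finite forest, which T places infinitely often among the constants; hence
-- for every ψ(x) there are finitely many constants such that each element y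
-- satisfies ψ(c) → ψ(y) for one of them, c.  So T proves ∀x ψ(x) as soon as it
-- proves these instances ψ(c), and T decides every sentence by induction on
-- the formula.  For consistency, the constants themselves form a model.

-- `Complete` asks for an actual decision of each sentence, so elementary equivalence of all models
-- of T would not by itself be enough: a quantified sentence needs a finite list of test instances,
-- computed from the formula alone and valid for every model at once. Facts about an arbitrary model
-- are undecidable; they are obtained only under double negation relative to B, which suffices
-- because satisfaction is stable under it.
--
-- For ψ, the number N bounds the levels that ψ can see. A node is controlled through its path to
-- the root, so positions are closed under parents and a move may add N + 1 elements. K bounds the
-- size that a position can reach in the game on ψ. The test list consists of the copies that meet ψ
-- and of K copies of the universal forest. Only the answer to the first move has to come from this
-- list.

-- Simultaneous substitution for variables and constants

extS-cong : ∀ {D : Set} {k l} {v v' : Fin k → Tm D l} → v ≗ v' → extS v ≗ extS v'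
extS-cong q zero    = refl
extS-cong q (suc x) = cong (renT suc) (q x)

module _ {C D : Set} where

  bindT : ∀ {k l} → (C → Tm D l) → (Fin k → Tm D l) → Tm C k → Tm D l
  bindT h v (var x) = v x
  bindT h v (con c) = h c

  -- Constants are replaced too, so that weakening, instantiation, change of language and turning a
  -- constant into a variable are all instances, and their commutation laws reduce to `bindF-∘`.
  bindF : ∀ {k l} → (C → Tm D l) → (Fin k → Tm D l) → Fm C k → Fm D l
  bindF h v (P i t)   = P i (bindT h v t)
  bindF h v (R i s t) = R i (bindT h v s) (bindT h v t)
  bindF h v (s ≐ t)   = bindT h v s ≐ bindT h v t
  bindF h v ⊥'        = ⊥'
  bindF h v (φ ⇒ ψ)   = bindF h v φ ⇒ bindF h v ψ
  bindF h v (∀' φ)    = ∀' (bindF (renT suc ∘ h) (extS v) φ)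

  bindT-cong : ∀ {k l} {h h' : C → Tm D l} {v v' : Fin k → Tm D l} →
    h ≗ h' → v ≗ v' → bindT h v ≗ bindT h' v'
  bindT-cong p q (var x) = q x
  bindT-cong p q (con c) = p c

  bindF-cong : ∀ {k l} {h h' : C → Tm D l} {v v' : Fin k → Tm D l} →
    h ≗ h' → v ≗ v' → bindF h v ≗ bindF h' v'
  bindF-cong p q (P i t)   = cong (P i) (bindT-cong p q t)
  bindF-cong p q (R i s t) = cong₂ (R i) (bindT-cong p q s) (bindT-cong p q t)
  bindF-cong p q (s ≐ t)   = cong₂ _≐_ (bindT-cong p q s) (bindT-cong p q t)
  bindF-cong p q ⊥'        = refl
  bindF-cong p q (φ ⇒ ψ)   = cong₂ _⇒_ (bindF-cong p q φ) (bindF-cong p q ψ)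
  bindF-cong p q (∀' φ)    =
    cong ∀' (bindF-cong (cong (renT suc) ∘ p) (extS-cong q) φ)

module _ {C D E : Set} where

  bindT-∘ : ∀ {k l m} (h₂ : D → Tm E m) (v₂ : Fin l → Tm E m)
    (h₁ : C → Tm D l) (v₁ : Fin k → Tm D l) (t : Tm C k) →
    bindT h₂ v₂ (bindT h₁ v₁ t) ≡ bindT (bindT h₂ v₂ ∘ h₁) (bindT h₂ v₂ ∘ v₁) t
  bindT-∘ h₂ v₂ h₁ v₁ (var x) = refl
  bindT-∘ h₂ v₂ h₁ v₁ (con c) = refl

bindT-ext : ∀ {D E : Set} {l m} (h : D → Tm E m) (v : Fin l → Tm E m) (t : Tm D l) →
  bindT (renT suc ∘ h) (extS v) (renT suc t) ≡ renT suc (bindT h v t)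
bindT-ext h v (var x) = refl
bindT-ext h v (con c) = refl

module _ {C D E : Set} where

  bindF-∘ : ∀ {k l m} (h₂ : D → Tm E m) (v₂ : Fin l → Tm E m)
    (h₁ : C → Tm D l) (v₁ : Fin k → Tm D l) (φ : Fm C k) →
    bindF h₂ v₂ (bindF h₁ v₁ φ) ≡ bindF (bindT h₂ v₂ ∘ h₁) (bindT h₂ v₂ ∘ v₁) φ
  bindF-∘ h₂ v₂ h₁ v₁ (P i t)   = cong (P i) (bindT-∘ h₂ v₂ h₁ v₁ t)
  bindF-∘ h₂ v₂ h₁ v₁ (R i s t) =
    cong₂ (R i) (bindT-∘ h₂ v₂ h₁ v₁ s) (bindT-∘ h₂ v₂ h₁ v₁ t)
  bindF-∘ h₂ v₂ h₁ v₁ (s ≐ t)   =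
    cong₂ _≐_ (bindT-∘ h₂ v₂ h₁ v₁ s) (bindT-∘ h₂ v₂ h₁ v₁ t)
  bindF-∘ h₂ v₂ h₁ v₁ ⊥'        = refl
  bindF-∘ h₂ v₂ h₁ v₁ (φ ⇒ ψ)   =
    cong₂ _⇒_ (bindF-∘ h₂ v₂ h₁ v₁ φ) (bindF-∘ h₂ v₂ h₁ v₁ ψ)
  bindF-∘ h₂ v₂ h₁ v₁ (∀' φ)    = cong ∀' (trans
    (bindF-∘ (renT suc ∘ h₂) (extS v₂) (renT suc ∘ h₁) (extS v₁) φ)
    (bindF-cong (λ c → bindT-ext h₂ v₂ (h₁ c))
      (λ { zero → refl ; (suc x) → bindT-ext h₂ v₂ (v₁ x) }) φ))

module _ {C : Set} where

  renT-bind : ∀ {k l} (ρ : Fin k → Fin l) (t : Tm C k) →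
    renT ρ t ≡ bindT con (var ∘ ρ) t
  renT-bind ρ (var x) = refl
  renT-bind ρ (con c) = refl

  renF-bind : ∀ {k l} (ρ : Fin k → Fin l) (φ : Fm C k) →
    renF ρ φ ≡ bindF con (var ∘ ρ) φ
  renF-bind ρ (P i t)   = cong (P i) (renT-bind ρ t)
  renF-bind ρ (R i s t) = cong₂ (R i) (renT-bind ρ s) (renT-bind ρ t)
  renF-bind ρ (s ≐ t)   = cong₂ _≐_ (renT-bind ρ s) (renT-bind ρ t)
  renF-bind ρ ⊥'        = refl
  renF-bind ρ (φ ⇒ ψ)   = cong₂ _⇒_ (renF-bind ρ φ) (renF-bind ρ ψ)
  renF-bind ρ (∀' φ)    = cong ∀' (trans (renF-bind (extR {C} ρ) φ)
    (bindF-cong (λ _ → refl) (λ { zero → refl ; (suc x) → refl }) φ))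

  subT-bind : ∀ {k l} (σ : Fin k → Tm C l) (t : Tm C k) → subT σ t ≡ bindT con σ t
  subT-bind σ (var x) = refl
  subT-bind σ (con c) = refl

  subF-bind : ∀ {k l} (σ : Fin k → Tm C l) (φ : Fm C k) → subF σ φ ≡ bindF con σ φ
  subF-bind σ (P i t)   = cong (P i) (subT-bind σ t)
  subF-bind σ (R i s t) = cong₂ (R i) (subT-bind σ s) (subT-bind σ t)
  subF-bind σ (s ≐ t)   = cong₂ _≐_ (subT-bind σ s) (subT-bind σ t)
  subF-bind σ ⊥'        = refl
  subF-bind σ (φ ⇒ ψ)   = cong₂ _⇒_ (subF-bind σ φ) (subF-bind σ ψ)
  subF-bind σ (∀' φ)    = cong ∀' (subF-bind (extS σ) φ)

  bindT-id : ∀ {k} (t : Tm C k) → bindT con var t ≡ t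
  bindT-id (var x) = refl
  bindT-id (con c) = refl

  bindF-id : ∀ {k} (φ : Fm C k) → bindF con var φ ≡ φ
  bindF-id (P i t)   = cong (P i) (bindT-id t)
  bindF-id (R i s t) = cong₂ (R i) (bindT-id s) (bindT-id t)
  bindF-id (s ≐ t)   = cong₂ _≐_ (bindT-id s) (bindT-id t)
  bindF-id ⊥'        = refl
  bindF-id (φ ⇒ ψ)   = cong₂ _⇒_ (bindF-id φ) (bindF-id ψ)
  bindF-id (∀' φ)    = cong ∀' (trans
    (bindF-cong (λ _ → refl) (λ { zero → refl ; (suc x) → refl }) φ) (bindF-id φ))

  inst-bind : ∀ {k} (φ : Fm C (suc k)) (t : Tm C k) → inst φ t ≡ bindF con (t ∷ var) φ
  inst-bind φ t = trans (subF-bind _ φ)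
    (bindF-cong (λ _ → refl) (λ { zero → refl ; (suc x) → refl }) φ)

module _ {C D : Set} where

  bindF-inst : ∀ {k l} (h : C → Tm D l) (v : Fin k → Tm D l) (φ : Fm C (suc k)) (t : Tm C k) →
    bindF h v (inst φ t) ≡ inst (bindF (renT suc ∘ h) (extS v) φ) (bindT h v t)
  bindF-inst h v φ t = begin
    bindF h v (inst φ t)                 ≡⟨ cong (bindF h v) (inst-bind φ t) ⟩
    bindF h v (bindF con (t ∷ var) φ)    ≡⟨ bindF-∘ h v con (t ∷ var) φ ⟩
    bindF h (bindT h v ∘ (t ∷ var)) φ    ≡⟨ bindF-cong (λ c → sym (inst-ren (h c)))
                                              (λ { zero → refl ; (suc x) → sym (inst-ren (v x)) }) φ ⟩
    bindF (bindT con (bindT h v t ∷ var) ∘ renT suc ∘ h)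
          (bindT con (bindT h v t ∷ var) ∘ extS v) φ
                                         ≡⟨ sym (bindF-∘ con _ (renT suc ∘ h) (extS v) φ) ⟩
    bindF con (bindT h v t ∷ var) (bindF (renT suc ∘ h) (extS v) φ)
                                         ≡⟨ sym (inst-bind _ (bindT h v t)) ⟩
    inst (bindF (renT suc ∘ h) (extS v) φ) (bindT h v t) ∎
    where
    open ≡-Reasoning
    inst-ren : ∀ {l} {u : Tm D l} (s : Tm D l) → bindT con (_∷_ u var) (renT suc s) ≡ s
    inst-ren (var x) = refl
    inst-ren (con c) = refl

  bindF-wk : ∀ {k l} (h : C → Tm D l) (v : Fin k → Tm D l) (φ : Fm C k) →
    bindF (renT suc ∘ h) (extS v) (wk φ) ≡ wk (bindF h v φ)
  bindF-wk h v φ = begin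
    bindF (renT suc ∘ h) (extS v) (wk φ)
      ≡⟨ cong (bindF _ _) (renF-bind suc φ) ⟩
    bindF (renT suc ∘ h) (extS v) (bindF con (var ∘ suc) φ)
      ≡⟨ bindF-∘ _ _ con (var ∘ suc) φ ⟩
    bindF (renT suc ∘ h) (renT suc ∘ v) φ
      ≡⟨ bindF-cong (λ c → renT-bind suc (h c)) (λ x → renT-bind suc (v x)) φ ⟩
    bindF (bindT con (var ∘ suc) ∘ h) (bindT con (var ∘ suc) ∘ v) φ
      ≡⟨ sym (bindF-∘ con _ h v φ) ⟩
    bindF con (var ∘ suc) (bindF h v φ)
      ≡⟨ sym (renF-bind suc _) ⟩
    wk (bindF h v φ) ∎
    where open ≡-Reasoning

  bindF-sentence-wk : ∀ {l} (h : C → Tm D l) (σ : Fm C 0) →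
    bindF (renT suc ∘ h) (λ ()) σ ≡ wk (bindF h (λ ()) σ)
  bindF-sentence-wk h σ = sym (trans (renF-bind suc (bindF h (λ ()) σ))
    (trans (bindF-∘ con (var ∘ suc) h (λ ()) σ)
      (bindF-cong (λ c → sym (renT-bind suc (h c))) (λ ()) σ)))

  bindF-close : ∀ {k l} (h : C → Tm D l) (v : Fin k → Tm D l) (σ : Fm C 0) →
    bindF h v (close σ) ≡ bindF h (λ ()) σ
  bindF-close h v σ = trans (cong (bindF h v) (renF-bind _ σ))
    (trans (bindF-∘ h v con _ σ) (bindF-cong (λ _ → refl) (λ ()) σ))

module _ {C : Set} where

  close-bind : ∀ {k} (σ : Fm C 0) → close {k = k} σ ≡ bindF con (λ ()) σ
  close-bind σ = trans (renF-bind _ σ) (bindF-cong (λ _ → refl) (λ ()) σ)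

  close-id : (σ : Fm C 0) → close σ ≡ σ
  close-id σ = trans (renF-bind _ σ)
    (trans (bindF-cong (λ _ → refl) (λ ()) σ) (bindF-id σ))

  wk-close : ∀ {k} (σ : Fm C 0) → wk (close {k = k} σ) ≡ close σ
  wk-close σ = trans (renF-bind suc (close σ))
    (trans (bindF-close con _ σ) (sym (close-bind σ)))

-- Derivations: substitution, deduction theorem, compactness

-- The axiom sets are compared through σ' because under gen the term h c is
-- weakened, so the image of an axiom must be a sentence.
Maps : ∀ {C D : Set} {l} → (C → Tm D l) → (Fm C 0 → Set) → (Fm D 0 → Set) → Set
Maps h Γ Δ = ∀ {σ} → Γ σ → Σ _ λ σ' → Δ σ' × bindF h (λ ()) σ ≡ close σ'

module _ {C D : Set} {Γ : Fm C 0 → Set} {Δ : Fm D 0 → Set} where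

  Maps-suc : ∀ {l} {h : C → Tm D l} → Maps h Γ Δ → Maps (renT suc ∘ h) Γ Δ
  Maps-suc {h = h} H {σ} a with H a
  ... | σ' , b , e = σ' , b ,
    trans (bindF-sentence-wk h σ) (trans (cong wk e) (wk-close σ'))

  -- With a constant sent to a variable this is generalisation on constants; with constants sent to
  -- constants it moves a derivation to another language.
  Der-bind : ∀ {k l} {h : C → Tm D l} → Maps h Γ Δ → (v : Fin k → Tm D l) →
    ∀ {φ} → Der Γ k φ → Der Δ l (bindF h v φ)
  Der-bind {h = h} H v (ax {σ = σ} a) with H a
  ... | σ' , b , e = subst (Der Δ _) (sym (trans (bindF-close h v σ) e)) (ax b)
  Der-bind H v (mp d e) = mp (Der-bind H v d) (Der-bind H v e)
  Der-bind H v (gen d) = gen (Der-bind (Maps-suc H) (extS v) d)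
  Der-bind H v (ax-K φ ψ) = ax-K _ _
  Der-bind H v (ax-S φ ψ χ) = ax-S _ _ _
  Der-bind H v (ax-DN φ) = ax-DN _
  Der-bind {h = h} H v (ax-inst φ t) =
    subst (λ χ → Der Δ _ (_ ⇒ χ)) (sym (bindF-inst h v φ t)) (ax-inst (bindF _ _ φ) _)
  Der-bind H v (ax-dist φ ψ) = ax-dist _ _
  Der-bind {h = h} H v (ax-vac φ) =
    subst (λ χ → Der Δ _ (bindF h v φ ⇒ ∀' χ)) (sym (bindF-wk h v φ)) (ax-vac (bindF h v φ))
  Der-bind H v (ax-refl t) = ax-refl _
  Der-bind {h = h} H v (ax-leib φ s t) =
    subst₂ (λ χ χ' → Der Δ _ (_ ⇒ χ ⇒ χ')) (sym (bindF-inst h v φ s)) (sym (bindF-inst h v φ t))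
      (ax-leib (bindF _ _ φ) _ _)

infixl 4 _,,_
_,,_ : ∀ {C} → (Fm C 0 → Set) → Fm C 0 → Fm C 0 → Set
(Γ ,, φ) ψ = Γ ψ ⊎ φ ≡ ψ

module _ {C : Set} where

  Der-mono : ∀ {Γ Δ : Fm C 0 → Set} → (∀ {σ} → Γ σ → Δ σ) →
    ∀ {k φ} → Der Γ k φ → Der Δ k φ
  Der-mono H (ax a) = ax (H a)
  Der-mono H (mp d e) = mp (Der-mono H d) (Der-mono H e)
  Der-mono H (gen d) = gen (Der-mono H d)
  Der-mono H (ax-K φ ψ) = ax-K φ ψ
  Der-mono H (ax-S φ ψ χ) = ax-S φ ψ χ
  Der-mono H (ax-DN φ) = ax-DN φ
  Der-mono H (ax-inst φ t) = ax-inst φ t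
  Der-mono H (ax-dist φ ψ) = ax-dist φ ψ
  Der-mono H (ax-vac φ) = ax-vac φ
  Der-mono H (ax-refl t) = ax-refl t
  Der-mono H (ax-leib φ s t) = ax-leib φ s t

  module _ {Γ : Fm C 0 → Set} where

    ax₀' : ∀ {σ} → Γ σ → Γ ⊢ σ
    ax₀' {σ} a = subst (Der Γ 0) (close-id σ) (ax a)

    ⇒-refl : ∀ {k} (φ : Fm C k) → Der Γ k (φ ⇒ φ)
    ⇒-refl φ = mp (mp (ax-S φ (φ ⇒ φ) φ) (ax-K φ (φ ⇒ φ))) (ax-K φ φ)

    const : ∀ {k} {φ ψ : Fm C k} → Der Γ k φ → Der Γ k (ψ ⇒ φ)
    const d = mp (ax-K _ _) d

    ap : ∀ {k} {φ ψ χ : Fm C k} → Der Γ k (χ ⇒ φ ⇒ ψ) → Der Γ k (χ ⇒ φ) → Der Γ k (χ ⇒ ψ)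
    ap d e = mp (mp (ax-S _ _ _) d) e

    ⇒-trans : ∀ {k} {φ ψ χ : Fm C k} → Der Γ k (φ ⇒ ψ) → Der Γ k (ψ ⇒ χ) → Der Γ k (φ ⇒ χ)
    ⇒-trans d e = ap (const e) d

    ⊥-elim' : ∀ {k} {φ : Fm C k} → Der Γ k (⊥' ⇒ φ)
    ⊥-elim' = ⇒-trans (ax-K _ _) (ax-DN _)

    -- Since `¬' φ` implies `φ ⇒ ψ`, a refutation of the implication also refutes `¬' φ`.
    ¬⇒-left : ∀ {k} {φ ψ : Fm C k} → Der Γ k (¬' (φ ⇒ ψ)) → Der Γ k φ
    ¬⇒-left {φ = φ} {ψ} d = mp (ax-DN φ) (⇒-trans (ap (const (mp (ax-S φ ⊥' ψ) (const ⊥-elim'))) (⇒-refl _)) d)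

    ¬⇒-right : ∀ {k} {φ ψ : Fm C k} → Der Γ k (¬' (φ ⇒ ψ)) → Der Γ k (¬' ψ)
    ¬⇒-right d = ⇒-trans (ax-K _ _) d

    -- The case of `gen` goes through because the discharged φ is a sentence: weakening leaves
    -- `close φ` unchanged, so `ax-vac` and `ax-dist` move the quantifier past it.
    deduction : ∀ {φ k ψ} → Der (Γ ,, φ) k ψ → Der Γ k (close φ ⇒ ψ)
    deduction (ax (inj₁ a)) = const (ax a)
    deduction (ax (inj₂ refl)) = ⇒-refl _
    deduction (mp d e) = ap (deduction d) (deduction e)
    deduction {φ} (gen {φ = ψ} d) = ⇒-trans (ax-vac _)
      (mp (ax-dist _ _) (gen (subst (λ χ → Der Γ _ (χ ⇒ ψ)) (sym (wk-close φ)) (deduction d))))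
    deduction (ax-K φ ψ) = const (ax-K φ ψ)
    deduction (ax-S φ ψ χ) = const (ax-S φ ψ χ)
    deduction (ax-DN φ) = const (ax-DN φ)
    deduction (ax-inst φ t) = const (ax-inst φ t)
    deduction (ax-dist φ ψ) = const (ax-dist φ ψ)
    deduction (ax-vac φ) = const (ax-vac φ)
    deduction (ax-refl t) = const (ax-refl t)
    deduction (ax-leib φ s t) = const (ax-leib φ s t)

    deduction₀ : ∀ {φ ψ} → (Γ ,, φ) ⊢ ψ → Γ ⊢ (φ ⇒ ψ)
    deduction₀ {φ} d = subst (λ χ → Der Γ 0 (χ ⇒ _)) (close-id φ) (deduction d)

  module _ {I : Set} (i₀ : I) (Ω : I → Fm C 0 → Set)
    (directed : ∀ i j → ∃ λ m → (∀ {σ} → Ω i σ → Ω m σ) × (∀ {σ} → Ω j σ → Ω m σ)) where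

    compactness : ∀ {k φ} → Der (λ σ → ∃ λ i → Ω i σ) k φ → ∃ λ i → Der (Ω i) k φ
    compactness (ax (i , a)) = i , ax a
    compactness (mp d e) with compactness d | compactness e
    ... | i , d' | j , e' =
      let m , p , q = directed i j in m , mp (Der-mono p d') (Der-mono q e')
    compactness (gen d) with compactness d
    ... | i , d' = i , gen d'
    compactness (ax-K φ ψ) = i₀ , ax-K φ ψ
    compactness (ax-S φ ψ χ) = i₀ , ax-S φ ψ χ
    compactness (ax-DN φ) = i₀ , ax-DN φ
    compactness (ax-inst φ t) = i₀ , ax-inst φ t
    compactness (ax-dist φ ψ) = i₀ , ax-dist φ ψ
    compactness (ax-vac φ) = i₀ , ax-vac φ
    compactness (ax-refl t) = i₀ , ax-refl t
    compactness (ax-leib φ s t) = i₀ , ax-leib φ s t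

  module _ (Ω : ℕ → Fm C 0 → Set) (step : ∀ {n σ} → Ω n σ → Ω (suc n) σ) where

    ⋃Ω : Fm C 0 → Set
    ⋃Ω σ = ∃ λ n → Ω n σ

    chain-≤ : ∀ {m σ} n → Ω m σ → Ω (n + m) σ
    chain-≤ zero    a = a
    chain-≤ (suc n) a = step (chain-≤ n a)

    chain-consistent : (∀ n → Ω (suc n) ⊢ ⊥' → Ω n ⊢ ⊥') → ⋃Ω ⊢ ⊥' → Ω 0 ⊢ ⊥'
    chain-consistent rel d = let n , e = compactness 0 Ω directed d in down n e
      where
      directed : ∀ i j → ∃ λ m → (∀ {σ} → Ω i σ → Ω m σ) × (∀ {σ} → Ω j σ → Ω m σ)
      directed i j = j + i , chain-≤ j , λ {σ} a → subst (λ m → Ω m σ) (+-comm i j) (chain-≤ i a)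
      down : ∀ n → Ω n ⊢ ⊥' → Ω 0 ⊢ ⊥'
      down zero    d = d
      down (suc n) d = down n (rel n d)

  -- A derivation either avoids the conditional axiom φ or supplies its condition A.
  conditional-axiom : ∀ {Γ : Fm C 0 → Set} {A : Set} {φ k ψ} →
    Der (λ σ → Γ σ ⊎ (φ ≡ σ × A)) k ψ → Der Γ k ψ ⊎ A
  conditional-axiom {Γ} {A} {φ} d with compactness {I = ⊤ ⊎ A} (inj₁ tt) fam directed (Der-mono to d)
    where
    fam : ⊤ ⊎ A → Fm C 0 → Set
    fam (inj₁ _) = Γ
    fam (inj₂ _) = Γ ,, φ
    to : ∀ {σ} → Γ σ ⊎ (φ ≡ σ × A) → ∃ λ i → fam i σ
    to (inj₁ a)       = inj₁ tt , a
    to (inj₂ (q , a)) = inj₂ a , inj₂ q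
    directed : ∀ i j → ∃ λ m → (∀ {σ} → fam i σ → fam m σ) × (∀ {σ} → fam j σ → fam m σ)
    directed (inj₁ _) (inj₁ _) = inj₁ tt , id , id
    directed (inj₁ _) (inj₂ a) = inj₂ a , inj₁ , id
    directed (inj₂ a) (inj₁ _) = inj₂ a , id , inj₁
    directed (inj₂ a) (inj₂ _) = inj₂ a , id , id
  ... | inj₁ _ , d' = inj₁ d'
  ... | inj₂ a , _  = inj₂ a

-- Enumeration of terms and formulas

Countable : Set → Set
Countable A = Σ (ℕ → A) λ e → ∀ a → ∃ λ n → e n ≡ a

-- Walks each antidiagonal from (s , 0) to (0 , s) and continues at (s + 1 , 0).
next : ℕ × ℕ → ℕ × ℕ
next (zero  , b) = suc b , 0
next (suc a , b) = a , suc b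

unpair : ℕ → ℕ × ℕ
unpair zero    = 0 , 0
unpair (suc n) = next (unpair n)

unpair-surjective : ∀ a b → ∃ λ n → unpair n ≡ (a , b)
unpair-surjective a b = reach (a + b) a b refl
  where
  reach : ∀ s a b → a + b ≡ s → ∃ λ n → unpair n ≡ (a , b)
  reach s       zero    zero    e = 0 , refl
  reach (suc s) (suc a) zero    e =
    let n , q = reach s 0 a (trans (sym (+-identityʳ a)) (cong Data.Nat.pred e)) in suc n , cong next q
  reach s       a       (suc b) e =
    let n , q = reach s (suc a) b (trans (sym (+-suc a b)) e) in suc n , cong next q

pair : ℕ → ℕ → ℕ
pair a b = proj₁ (unpair-surjective a b)

unpair-pair : ∀ a b → unpair (pair a b) ≡ (a , b)
unpair-pair a b = proj₂ (unpair-surjective a b)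

module _ {C : Set} (countable : Countable C) where

  private
    e = proj₁ countable

  decodeTm : ∀ k → ℕ → Tm C k
  decodeTm k n with unpair n
  ... | zero  , m = con (e m)
  ... | suc _ , m with m <? k
  ...   | yes m<k = var (fromℕ< m<k)
  ...   | no  _   = con (e 0)

  decodeTm-surjective : ∀ {k} (t : Tm C k) → ∃ λ n → decodeTm k n ≡ t
  decodeTm-surjective (con c) with proj₂ countable c
  ... | m , refl = pair 0 m , eq
    where
    eq : ∀ {k} → decodeTm k (pair 0 m) ≡ con (e m)
    eq rewrite unpair-pair 0 m = refl
  decodeTm-surjective {k} (var x) = pair 1 (toℕ x) , eq
    where
    eq : decodeTm k (pair 1 (toℕ x)) ≡ var x
    eq rewrite unpair-pair 1 (toℕ x) with toℕ x <? k
    ... | yes p = cong var (Fin.fromℕ<-toℕ x p)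
    ... | no ¬p = ⊥-elim (¬p (Fin.toℕ<n x))

  -- The first argument is fuel for the nesting depth, which makes the recursion structural;
  -- `countableFm` stores the fuel in the code. Codes without meaning get junk values, harmless
  -- since only surjectivity is wanted.
  decodeFm : ℕ → ∀ k → ℕ → Fm C k
  decodeTag : ℕ → ∀ k → ℕ → ℕ × ℕ → Fm C k

  decodeFm zero    k n = ⊥'
  decodeFm (suc f) k n = decodeTag f k (proj₁ (unpair n)) (unpair (proj₂ (unpair n)))

  decodeTag f k 0 (a , b) = P a (decodeTm k b)
  decodeTag f k 1 (a , b) = R a (decodeTm k (proj₁ (unpair b))) (decodeTm k (proj₂ (unpair b)))
  decodeTag f k 2 (a , b) = decodeTm k a ≐ decodeTm k b
  decodeTag f k 3 (a , b) = decodeFm f k a ⇒ decodeFm f k b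
  decodeTag f k 4 (a , b) = ∀' (decodeFm f (suc k) a)
  decodeTag f k _ (a , b) = ⊥'

  decodeFm-pair : ∀ f k t a b → decodeFm (suc f) k (pair t (pair a b)) ≡ decodeTag f k t (a , b)
  decodeFm-pair f k t a b rewrite unpair-pair t (pair a b) | unpair-pair a b = refl

  depth : ∀ {k} → Fm C k → ℕ
  depth (P i t)   = 1
  depth (R i s t) = 1
  depth (s ≐ t)   = 1
  depth ⊥'        = 0
  depth (φ ⇒ ψ)   = suc (depth φ ⊔ depth ψ)
  depth (∀' φ)    = suc (depth φ)

  decodeFm-surjective : ∀ {k} (φ : Fm C k) f → depth φ ≤ f → ∃ λ n → decodeFm f k n ≡ φ
  decodeFm-surjective {k} (P i t) (suc f) _ with decodeTm-surjective t
  ... | b , refl = pair 0 (pair i b) , decodeFm-pair f k 0 i b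
  decodeFm-surjective {k} (R i s t) (suc f) _ with decodeTm-surjective s | decodeTm-surjective t
  ... | a , refl | b , refl = pair 1 (pair i (pair a b)) ,
    trans (decodeFm-pair f k 1 i (pair a b))
      (cong (λ p → R i (decodeTm k (proj₁ p)) (decodeTm k (proj₂ p))) (unpair-pair a b))
  decodeFm-surjective {k} (s ≐ t) (suc f) _ with decodeTm-surjective s | decodeTm-surjective t
  ... | a , refl | b , refl = pair 2 (pair a b) , decodeFm-pair f k 2 a b
  decodeFm-surjective {k} ⊥' zero    _ = 0 , refl
  decodeFm-surjective {k} ⊥' (suc f) _ = pair 5 (pair 0 0) , decodeFm-pair f k 5 0 0
  decodeFm-surjective {k} (φ ⇒ ψ) (suc f) (s≤s p)
    with decodeFm-surjective φ f (≤-trans (m≤m⊔n _ _) p)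
       | decodeFm-surjective ψ f (≤-trans (m≤n⊔m (depth φ) _) p)
  ... | a , q | b , r = pair 3 (pair a b) , trans (decodeFm-pair f k 3 a b) (cong₂ _⇒_ q r)
  decodeFm-surjective {k} (∀' φ) (suc f) (s≤s p) with decodeFm-surjective φ f p
  ... | a , q = pair 4 (pair a 0) , trans (decodeFm-pair f k 4 a 0) (cong ∀' q)

  countableFm : ∀ k → Countable (Fm C k)
  countableFm k = (λ n → decodeFm (proj₁ (unpair n)) k (proj₂ (unpair n))) , λ φ →
    let n , q = decodeFm-surjective φ (depth φ) ≤-refl
        f = depth φ
    in pair f n , trans (cong (λ p → decodeFm (proj₁ p) k (proj₂ p)) (unpair-pair f n)) q

  countable-⊎ℕ : Countable (C ⊎ ℕ)
  countable-⊎ℕ = (λ n → dec (unpair n)) , surj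
    where
    dec : ℕ × ℕ → C ⊎ ℕ
    dec (zero  , m) = inj₁ (e m)
    dec (suc _ , m) = inj₂ m
    surj : ∀ a → ∃ λ n → dec (unpair n) ≡ a
    surj (inj₁ c) = let m , q = proj₂ countable c in
      pair 0 m , trans (cong dec (unpair-pair 0 m)) (cong inj₁ q)
    surj (inj₂ m) = pair 1 m , cong dec (unpair-pair 1 m)

-- Formulas whose constants satisfy a predicate

module _ {C : Set} (Q : C → Set) where

  OnT : ∀ {k} → Tm C k → Set
  OnT (var x) = ⊤
  OnT (con c) = Q c

  OnF : ∀ {k} → Fm C k → Set
  OnF (P i t)   = OnT t
  OnF (R i s t) = OnT s × OnT t
  OnF (s ≐ t)   = OnT s × OnT t
  OnF ⊥'        = ⊤
  OnF (φ ⇒ ψ)   = OnF φ × OnF ψ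
  OnF (∀' φ)    = OnF φ

OnT-renT : ∀ {C : Set} {Q : C → Set} {k l} {ρ : Fin k → Fin l} (t : Tm C k) →
  OnT Q t → OnT Q (renT ρ t)
OnT-renT (var x) q = tt
OnT-renT (con c) q = q

module _ {C D : Set} {Q : C → Set} {Q' : D → Set} where

  OnT-bind : ∀ {k l} {h : C → Tm D l} {v : Fin k → Tm D l} →
    (∀ c → Q c → OnT Q' (h c)) → (∀ x → OnT Q' (v x)) → ∀ t → OnT Q t → OnT Q' (bindT h v t)
  OnT-bind H V (var x) q = V x
  OnT-bind H V (con c) q = H c q

  OnF-bind : ∀ {k l} {h : C → Tm D l} {v : Fin k → Tm D l} →
    (∀ c → Q c → OnT Q' (h c)) → (∀ x → OnT Q' (v x)) → ∀ φ → OnF Q φ → OnF Q' (bindF h v φ)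
  OnF-bind H V (P i t)   q       = OnT-bind H V t q
  OnF-bind H V (R i s t) (q , r) = OnT-bind H V s q , OnT-bind H V t r
  OnF-bind H V (s ≐ t)   (q , r) = OnT-bind H V s q , OnT-bind H V t r
  OnF-bind H V ⊥'        q       = tt
  OnF-bind H V (φ ⇒ ψ)   (q , r) = OnF-bind H V φ q , OnF-bind H V ψ r
  OnF-bind {h = h} {v} H V (∀' φ) q = OnF-bind (λ c r → OnT-renT (h c) (H c r))
    (λ { zero → tt ; (suc x) → OnT-renT (v x) (V x) }) φ q

module _ {C D : Set} {Q : C → Set} where

  bindT-agree : ∀ {k l} {h h' : C → Tm D l} {v v' : Fin k → Tm D l} →
    (∀ c → Q c → h c ≡ h' c) → v ≗ v' → ∀ t → OnT Q t → bindT h v t ≡ bindT h' v' t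
  bindT-agree H V (var x) q = V x
  bindT-agree H V (con c) q = H c q

  bindF-agree : ∀ {k l} {h h' : C → Tm D l} {v v' : Fin k → Tm D l} →
    (∀ c → Q c → h c ≡ h' c) → v ≗ v' → ∀ φ → OnF Q φ → bindF h v φ ≡ bindF h' v' φ
  bindF-agree H V (P i t)   q       = cong (P i) (bindT-agree H V t q)
  bindF-agree H V (R i s t) (q , r) = cong₂ (R i) (bindT-agree H V s q) (bindT-agree H V t r)
  bindF-agree H V (s ≐ t)   (q , r) = cong₂ _≐_ (bindT-agree H V s q) (bindT-agree H V t r)
  bindF-agree H V ⊥'        q       = refl
  bindF-agree H V (φ ⇒ ψ)   (q , r) = cong₂ _⇒_ (bindF-agree H V φ q) (bindF-agree H V ψ r)
  bindF-agree H V (∀' φ)    q       = cong ∀'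
    (bindF-agree (λ c r → cong (renT suc) (H c r)) (extS-cong V) φ q)

module _ {C : Set} {Q Q' : C → Set} (H : ∀ {c} → Q c → Q' c) where

  OnF-mono : ∀ {k} (φ : Fm C k) → OnF Q φ → OnF Q' φ
  OnF-mono φ q = subst (OnF Q') (bindF-id φ) (OnF-bind (λ _ → H) (λ _ → tt) φ q)

OnT-all : ∀ {C : Set} {Q : C → Set} → (∀ c → Q c) → ∀ {k} (t : Tm C k) → OnT Q t
OnT-all H (var x) = tt
OnT-all H (con c) = H c

OnF-all : ∀ {C : Set} {Q : C → Set} → (∀ c → Q c) → ∀ {k} (φ : Fm C k) → OnF Q φ
OnF-all H (P i t)   = OnT-all H t
OnF-all H (R i s t) = OnT-all H s , OnT-all H t
OnF-all H (s ≐ t)   = OnT-all H s , OnT-all H t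
OnF-all H ⊥'        = tt
OnF-all H (φ ⇒ ψ)   = OnF-all H φ , OnF-all H ψ
OnF-all H (∀' φ)    = OnF-all H φ

-- Henkin completeness

module _ {C : Set} where

  Below : ℕ → C ⊎ ℕ → Set
  Below m (inj₁ c) = ⊤
  Below m (inj₂ n) = n < m

  Below-mono : ∀ {m m'} → m ≤ m' → ∀ {c} → Below m c → Below m' c
  Below-mono m≤m' {inj₁ c} q = tt
  Below-mono m≤m' {inj₂ n} q = ≤-trans q m≤m'

  boundT : ∀ {k} (t : Tm (C ⊎ ℕ) k) → ∃ λ m → OnT (Below m) t
  boundT (var x)        = 0 , tt
  boundT (con (inj₁ c)) = 0 , tt
  boundT (con (inj₂ n)) = suc n , ≤-refl

  bound₂ : ∀ {k} (s t : Tm (C ⊎ ℕ) k) → ∃ λ m → OnT (Below m) s × OnT (Below m) t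
  bound₂ s t =
    let m , p = boundT s ; n , q = boundT t in
    m + n , OnF-mono (Below-mono (m≤m+n m n)) (P 0 s) p , OnF-mono (Below-mono (m≤n+m n m)) (P 0 t) q

  bound : ∀ {k} (φ : Fm (C ⊎ ℕ) k) → ∃ λ m → OnF (Below m) φ
  bound (P i t)   = boundT t
  bound (R i s t) = bound₂ s t
  bound (s ≐ t)   = bound₂ s t
  bound ⊥'        = 0 , tt
  bound (φ ⇒ ψ)   =
    let m , p = bound φ ; n , q = bound ψ in
    m + n , OnF-mono (Below-mono (m≤m+n m n)) φ p , OnF-mono (Below-mono (m≤n+m n m)) ψ q
  bound (∀' φ)    = bound φ

  abstractC : ℕ → C ⊎ ℕ → Tm (C ⊎ ℕ) 1
  abstractC m (inj₁ c) = con (inj₁ c)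
  abstractC m (inj₂ n) with n ≟ m
  ... | yes _ = var zero
  ... | no  _ = con (inj₂ n)

  abstractC-self : ∀ m → abstractC m (inj₂ m) ≡ var zero
  abstractC-self m with m ≟ m
  ... | yes _ = refl
  ... | no  q = ⊥-elim (q refl)

  abstractC-below : ∀ m c → Below m c → abstractC m c ≡ con c
  abstractC-below m (inj₁ c) q = refl
  abstractC-below m (inj₂ n) q with n ≟ m
  ... | yes refl = ⊥-elim (<-irrefl refl q)
  ... | no  _    = refl

  henkin : ℕ → Fm (C ⊎ ℕ) 1 → Fm (C ⊎ ℕ) 0
  henkin m φ = inst φ (con (inj₂ m)) ⇒ ∀' φ

  henkin-below : ∀ m φ → OnF (Below m) φ → OnF (Below (suc m)) (henkin m φ)
  henkin-below m φ q = subst (OnF _) (sym (inst-bind φ _))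
      (OnF-bind (λ c r → Below-mono (n≤1+n m) {c} r) (λ { zero → ≤-refl }) φ q) ,
    OnF-mono (Below-mono (n≤1+n m)) φ q

  -- A refutation of the Henkin axiom proves φ at the new constant and refutes `∀' φ`. The constant
  -- occurs neither in Γ nor in φ, so `abstractC` turns the first into a proof of φ with a free
  -- variable, and `gen` contradicts the second.
  henkin-consistent : ∀ {Γ : Fm (C ⊎ ℕ) 0 → Set} {m φ} →
    (∀ {σ} → Γ σ → OnF (Below m) σ) → OnF (Below m) φ → (Γ ,, henkin m φ) ⊢ ⊥' → Γ ⊢ ⊥'
  henkin-consistent {Γ} {m} {φ} fresh q d =
    mp (¬⇒-right d') (gen (subst (Der Γ 1) eq (Der-bind maps (λ ()) (¬⇒-left d'))))
    where
    d' : Γ ⊢ ¬' (henkin m φ)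
    d' = deduction₀ d
    maps : Maps (abstractC m) Γ Γ
    maps {σ} a = σ , a , trans
      (bindF-agree (abstractC-below m) (λ ()) σ (fresh a)) (sym (close-bind σ))
    eq : bindF (abstractC m) (λ ()) (inst φ (con (inj₂ m))) ≡ φ
    eq = trans (cong (bindF _ _) (inst-bind φ _))
      (trans (bindF-∘ (abstractC m) (λ ()) con (_∷_ (con (inj₂ m)) var) φ)
      (trans (bindF-agree (abstractC-below m) (λ { zero → abstractC-self m }) φ q) (bindF-id φ)))

  module Henkin (countable : Countable (Fm (C ⊎ ℕ) 1)) (Γ : Fm (C ⊎ ℕ) 0 → Set)
                (fresh : ∀ {σ} → Γ σ → OnF (Below 0) σ) where

    body : ℕ → Fm (C ⊎ ℕ) 1
    body = proj₁ countable

    -- The Henkin constant for `body n` must be new to the earlier axioms and to `body n` itself; a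
    -- sum of the two bounds exceeds both.
    index used : ℕ → ℕ
    used zero    = 0
    used (suc n) = suc (index n)
    index n = used n + proj₁ (bound (body n))

    Θ : ℕ → Fm (C ⊎ ℕ) 0 → Set
    Θ zero    = Γ
    Θ (suc n) = Θ n ,, henkin (index n) (body n)

    body-below : ∀ n → OnF (Below (index n)) (body n)
    body-below n = OnF-mono (Below-mono (m≤n+m _ (used n))) (body n) (proj₂ (bound (body n)))

    Θ-below : ∀ n {σ} → Θ n σ → OnF (Below (used n)) σ
    Θ-below zero    a = fresh a
    Θ-below (suc n) {σ} (inj₁ a) =
      OnF-mono (Below-mono (≤-trans (m≤m+n _ _) (n≤1+n _))) σ (Θ-below n a)
    Θ-below (suc n) (inj₂ refl) = henkin-below (index n) (body n) (body-below n)

    Henkinized : Fm (C ⊎ ℕ) 0 → Set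
    Henkinized = ⋃Ω Θ inj₁

    Henkinized-consistent : Henkinized ⊢ ⊥' → Γ ⊢ ⊥'
    Henkinized-consistent = chain-consistent Θ inj₁ λ n →
      henkin-consistent {φ = body n} (λ {σ} a → OnF-mono (Below-mono (m≤m+n _ _)) σ (Θ-below n a)) (body-below n)

    Henkinized-∀ : ∀ φ → ∃ λ c → Henkinized (inst φ (con c) ⇒ ∀' φ)
    Henkinized-∀ φ with proj₂ countable φ
    ... | n , refl = inj₂ (index n) , suc n , inj₂ refl

module Lindenbaum {C : Set} (countable : Countable (Fm C 0)) (Θ : Fm C 0 → Set) where

  sentence : ℕ → Fm C 0
  sentence = proj₁ countable

  -- Whether a sentence can be added consistently is undecidable, so no choice is made: relative
  -- consistency becomes part of the evidence for membership.
  Ω : ℕ → Fm C 0 → Set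
  Ω zero    = Θ
  Ω (suc n) φ = Ω n φ ⊎ (sentence n ≡ φ × ((Ω n ,, φ) ⊢ ⊥' → Ω n ⊢ ⊥'))

  Maximal : Fm C 0 → Set
  Maximal = ⋃Ω Ω inj₁

  -- A refutation either avoids the new sentence or contains evidence of its relative consistency;
  -- in the latter case this evidence, applied to the refutation itself, finishes the proof.
  Ω-relative : ∀ n → Ω (suc n) ⊢ ⊥' → Ω n ⊢ ⊥'
  Ω-relative n d with conditional-axiom (Der-mono split d)
    where
    split : ∀ {σ} → Ω (suc n) σ →
      Ω n σ ⊎ (sentence n ≡ σ × ((Ω n ,, sentence n) ⊢ ⊥' → Ω n ⊢ ⊥'))
    split (inj₁ a)          = inj₁ a
    split (inj₂ (refl , c)) = inj₂ (refl , c)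
  ... | inj₁ d' = d'
  ... | inj₂ c  = c (Der-mono (λ { (inj₁ a) → inj₁ a ; (inj₂ (q , _)) → inj₂ q }) d)

  Maximal-consistent : Maximal ⊢ ⊥' → Θ ⊢ ⊥'
  Maximal-consistent = chain-consistent Ω inj₁ Ω-relative

  maximal : ∀ φ → ((Maximal ,, φ) ⊢ ⊥' → Maximal ⊢ ⊥') → Maximal φ
  maximal φ H with proj₂ countable φ
  -- H speaks of `Maximal`, the condition to be shown of stage n. An inconsistency of `Maximal`
  -- descends to Θ, and Θ is contained in every stage.
  ... | n , refl = suc n , inj₂ (refl , λ d → Der-mono (chain-≤0 n)
      (Maximal-consistent (H (Der-mono (λ { (inj₁ a) → inj₁ (n , a) ; (inj₂ q) → inj₂ q }) d))))
    where
    chain-≤0 : ∀ n {σ} → Θ σ → Ω n σ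
    chain-≤0 zero    a = a
    chain-≤0 (suc n) a = inj₁ (chain-≤0 n a)

  -- A refutation of the implication proves φ and refutes ψ, while H yields ψ, so adding the
  -- implication is relatively consistent. In the truth lemma this replaces the dichotomy between a
  -- sentence and its negation.
  maximal-⇒ : ∀ {φ ψ} → (Maximal ⊢ φ → Maximal ⊢ ψ) → Maximal ⊢ (φ ⇒ ψ)
  maximal-⇒ {φ} {ψ} H = ax₀' (maximal (φ ⇒ ψ) λ d →
    let d' = deduction₀ d in mp (¬⇒-right d') (H (¬⇒-left d')))

  maximal-stable : ∀ {φ} → ((Maximal ⊢ φ → Maximal ⊢ ⊥') → Maximal ⊢ ⊥') → Maximal ⊢ φ
  maximal-stable {φ} H = mp (ax-DN φ) (maximal-⇒ λ d → H (mp d))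

-- Exploding models

-- Equality is a congruence because the canonical domain consists of constants that are not
-- identified. The stability fields say that atoms are closed under double negation relative to B,
-- so in particular B implies every atom.
record XModel (C : Set) : Set₁ where
  infix 4 _≈_
  field
    B   : Set
    Dom : Set
    _≈_ : Dom → Dom → Set
    Pˣ  : ℕ → Dom → Set
    Rˣ  : ℕ → Dom → Dom → Set
    cˣ  : C → Dom
    ≈-refl   : ∀ {x} → x ≈ x
    ≈-sym    : ∀ {x y} → x ≈ y → y ≈ x
    ≈-trans  : ∀ {x y z} → x ≈ y → y ≈ z → x ≈ z
    P-cong   : ∀ {i x y} → x ≈ y → Pˣ i x → Pˣ i y
    R-cong   : ∀ {i x x' y y'} → x ≈ x' → y ≈ y' → Rˣ i x y → Rˣ i x' y'
    ≈-stable : ∀ {x y} → ((x ≈ y → B) → B) → x ≈ y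
    P-stable : ∀ {i x} → ((Pˣ i x → B) → B) → Pˣ i x
    R-stable : ∀ {i x y} → ((Rˣ i x y → B) → B) → Rˣ i x y

module _ {C : Set} (𝓜 : XModel C) where
  open XModel 𝓜

  evalX : ∀ {k} → Tm C k → (Fin k → Dom) → Dom
  evalX (var x) ρ = ρ x
  evalX (con c) ρ = cˣ c

  SatX : ∀ {k} → Fm C k → (Fin k → Dom) → Set
  SatX (P i t)   ρ = Pˣ i (evalX t ρ)
  SatX (R i s t) ρ = Rˣ i (evalX s ρ) (evalX t ρ)
  SatX (s ≐ t)   ρ = evalX s ρ ≈ evalX t ρ
  SatX ⊥'        ρ = B
  SatX (φ ⇒ ψ)   ρ = SatX φ ρ → SatX ψ ρ
  SatX (∀' φ)    ρ = (a : Dom) → SatX φ (a ∷ ρ)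

_⊨ˣ_ : {C : Set} → XModel C → Fm C 0 → Set
𝓜 ⊨ˣ φ = SatX 𝓜 φ (λ ())

-- The canonical exploding model and completeness

module Canonical {C : Set} (countable : Countable C) (Γ : Fm C 0 → Set) (χ : Fm C 0) where

  D : Set
  D = C ⊎ ℕ

  h : ∀ {k} → C → Tm D k
  h c = con (inj₁ c)

  Γ' : Fm D 0 → Set
  Γ' σ' = ∃ λ σ → (Γ ,, ¬' χ) σ × σ' ≡ bindF h (λ ()) σ

  countableD : ∀ k → Countable (Fm D k)
  countableD = countableFm (countable-⊎ℕ countable)

  Γ'-below : ∀ {σ} → Γ' σ → OnF (Below 0) σ
  Γ'-below (σ , _ , q) = subst (OnF _) (sym q)
    (OnF-bind {Q = λ _ → ⊤} (λ _ _ → tt) (λ ()) σ (OnF-all (λ _ → tt) σ))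

  open Henkin (countableD 1) Γ' Γ'-below
  open Lindenbaum (countableD 0) Henkinized

  embed : ∀ {σ} → (Γ ,, ¬' χ) ⊢ σ → Maximal ⊢ bindF h (λ ()) σ
  embed = Der-bind (λ {σ} a → bindF h (λ ()) σ , (0 , 0 , σ , a , refl) , sym (close-id _)) (λ ())

  inconsistent : Maximal ⊢ ⊥' → Γ ⊢ χ
  inconsistent d = mp (ax-DN χ) (deduction₀ (Der-bind maps (λ ())
    (Henkinized-consistent (Maximal-consistent d))))
    where
    back : ∀ {k} → D → Tm C k
    back (inj₁ c) = con c
    -- The Henkin axioms are gone by now, but the refutation may still mention their constants; any
    -- constant of C can replace them.
    back (inj₂ _) = con (proj₁ countable 0)
    maps : Maps back Γ' (Γ ,, ¬' χ)
    maps (σ , a , q) = σ , a , trans (cong (bindF back (λ ())) q) (trans (bindF-∘ back (λ ()) h (λ ()) σ)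
      (trans (bindF-cong (λ _ → refl) (λ ()) σ) (sym (close-bind σ))))

  leibniz : ∀ (φ : Fm D 1) {c d} → Maximal ⊢ (con c ≐ con d) →
    Maximal ⊢ inst φ (con c) → Maximal ⊢ inst φ (con d)
  leibniz φ q e = mp (mp (ax-leib φ _ _) q) e

  canonical : XModel C
  canonical = record
    { B   = Maximal ⊢ ⊥'
    ; Dom = D
    ; _≈_ = λ c d → Maximal ⊢ (con c ≐ con d)
    ; Pˣ  = λ i c → Maximal ⊢ P i (con c)
    ; Rˣ  = λ i c d → Maximal ⊢ R i (con c) (con d)
    ; cˣ  = inj₁
    ; ≈-refl   = ax-refl _
    ; ≈-sym    = λ {x} q → leibniz (x₀ ≐ con x) q (ax-refl _)
    ; ≈-trans  = λ {x} q r → leibniz (con x ≐ x₀) r q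
    ; P-cong   = λ {i} → leibniz (P i x₀)
    ; R-cong   = λ {i} {x' = x'} {y = y} q r a → leibniz (R i (con x') x₀) r (leibniz (R i x₀ (con y)) q a)
    ; ≈-stable = maximal-stable
    ; P-stable = maximal-stable
    ; R-stable = maximal-stable
    }

  τ : ∀ {k} → (Fin k → D) → Fm C k → Fm D 0
  τ ρ = bindF h (con ∘ ρ)

  τ-inst : ∀ {k} (ρ : Fin k → D) (φ : Fm C (suc k)) d →
    inst (bindF (renT suc ∘ h) (extS (con ∘ ρ)) φ) (con d) ≡ τ (d ∷ ρ) φ
  τ-inst ρ φ d = trans (inst-bind (bindF _ _ φ) _)
    (trans (bindF-∘ con _ (renT suc ∘ h) (extS (con ∘ ρ)) φ)
      (bindF-cong (λ _ → refl) (λ { zero → refl ; (suc x) → refl }) φ))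

  eval-τ : ∀ {k} (ρ : Fin k → D) (t : Tm C k) → con (evalX canonical t ρ) ≡ bindT {l = 0} h (con ∘ ρ) t
  eval-τ ρ (var x) = refl
  eval-τ ρ (con c) = refl

  truth : ∀ {k} (φ : Fm C k) ρ → (SatX canonical φ ρ → Maximal ⊢ τ ρ φ) × (Maximal ⊢ τ ρ φ → SatX canonical φ ρ)
  truth (P i t) ρ rewrite eval-τ ρ t = id , id
  truth (R i s t) ρ rewrite eval-τ ρ s | eval-τ ρ t = id , id
  truth (s ≐ t) ρ rewrite eval-τ ρ s | eval-τ ρ t = id , id
  truth ⊥' ρ = id , id
  truth (φ ⇒ ψ) ρ =
    let to , from = truth φ ρ ; to' , from' = truth ψ ρ in
    (λ a → maximal-⇒ (λ d → to' (a (from d)))) , (λ d a → from' (mp d (to a)))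
  truth (∀' φ) ρ =
    (λ a → let β = bindF (renT suc ∘ h) (extS (con ∘ ρ)) φ
               c , ax-c = Henkinized-∀ β
           in mp (ax₀' (0 , ax-c)) (subst (Maximal ⊢_) (sym (τ-inst ρ φ c)) (proj₁ (truth φ (c ∷ ρ)) (a c)))) ,
    (λ d c → proj₂ (truth φ (c ∷ ρ)) (subst (Maximal ⊢_) (τ-inst ρ φ c) (mp (ax-inst _ (con c)) d)))

  truth₀ : ∀ σ → (canonical ⊨ˣ σ → Maximal ⊢ bindF h (λ ()) σ) × (Maximal ⊢ bindF h (λ ()) σ → canonical ⊨ˣ σ)
  truth₀ σ = subst (λ χ → (canonical ⊨ˣ σ → Maximal ⊢ χ) × (Maximal ⊢ χ → canonical ⊨ˣ σ))
    (bindF-cong (λ _ → refl) (λ ()) σ) (truth σ (λ ()))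

-- The canonical model of Γ with `¬' χ` exists whether or not these are consistent. If χ holds in
-- it, then `Maximal` proves both χ and its negation, and `inconsistent` converts that into a
-- derivation from Γ.
completeness : {C : Set} → Countable C → (Γ : Fm C 0 → Set) (χ : Fm C 0) →
  ((𝓜 : XModel C) → (∀ {σ} → Γ ⊢ σ → 𝓜 ⊨ˣ σ) → 𝓜 ⊨ˣ χ) → Γ ⊢ χ
completeness countable Γ χ valid = inconsistent (mp
    (embed (ax₀' (inj₂ refl)))
    (proj₁ (truth₀ χ) (valid canonical λ {σ} d → proj₂ (truth₀ σ) (embed (Der-mono inj₁ d)))))
  where open Canonical countable Γ χ

-- Classical reasoning towards B, forests and truncated types

module Classical (B : Set) where

  -- Double negation relative to B; excluded middle holds inside this monad, and `SatX-stable`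
  -- allows leaving it whenever the goal is the satisfaction of a formula.
  M : Set → Set
  M A = (A → B) → B

  infixl 1 _>>=_
  _>>=_ : ∀ {A A' : Set} → M A → (A → M A') → M A'
  (m >>= f) k = m λ a → f a k

  return : ∀ {A : Set} → A → M A
  return a k = k a

  absurd : ∀ {A : Set} → B → M A
  absurd b _ = b

  em : (A : Set) → M (A ⊎ (A → B))
  em A k = k (inj₂ λ a → k (inj₁ a))

  choice : ∀ n {F : Fin n → Set} → (∀ a → M (F a)) → M (∀ a → F a)
  choice zero    f = return λ ()
  choice (suc n) f = f zero >>= λ x → choice n (f ∘ suc) >>= λ g →
    return λ { zero → x ; (suc a) → g a }

record Forest {C : Set} (𝓜 : XModel C) : Set where
  open XModel 𝓜
  open Classical B
  field
    disjoint : ∀ {i j x} → i ≢ j → Pˣ i x → Pˣ j x → B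
    R-source : ∀ {i x y} → Rˣ i x y → Pˣ i x
    R-target : ∀ {i x y} → Rˣ i x y → Pˣ (suc i) y
    parent   : ∀ {i x} → Pˣ (suc i) x → M (∃ λ y → Rˣ i y x)
    unique   : ∀ {i x y z} → Rˣ i x z → Rˣ i y z → x ≈ y

funToFin-cong : ∀ {m n} {f g : Fin m → Fin n} → f ≗ g → funToFin f ≡ funToFin g
funToFin-cong {zero}  H = refl
funToFin-cong {suc m} H = cong₂ combine (H zero) (funToFin-cong (H ∘ suc))

-- The type of a node with d levels below it records, for each type of its
-- children, the number of children of that type, truncated at K.

module Types (K : ℕ) where

  types : ℕ → ℕ
  types zero    = 1
  types (suc d) = suc K ^ types d

  count : ∀ d → Fin (types (suc d)) → Fin (types d) → ℕ
  count d t s = toℕ (finToFun {suc K} {types d} t s)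

  count≤K : ∀ d t s → count d t s ≤ K
  count≤K d t s = ≤-pred (Fin.toℕ<n (finToFun {suc K} {types d} t s))

  count-injective : ∀ d t t' → (∀ s → count d t s ≡ count d t' s) → t ≡ t'
  count-injective d t t' H = trans (sym (Fin.funToFin-finToFin {types d} {suc K} t))
    (trans (funToFin-cong (λ s → Fin.toℕ-injective (H s))) (Fin.funToFin-finToFin {types d} {suc K} t'))

  fromCounts : ∀ d (j : Fin (types d) → ℕ) → (∀ s → j s ≤ K) →
    ∃ λ t → ∀ s → count d t s ≡ j s
  fromCounts d j j≤K = funToFin (λ s → fromℕ< (s≤s (j≤K s))) , λ s →
    trans (cong toℕ (Fin.finToFun-funToFin (λ s → fromℕ< (s≤s (j≤K s))) s)) (Fin.toℕ-fromℕ< _)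

module _ {C : Set} (𝓜 : XModel C) where
  open XModel 𝓜
  open Classical B

  SatX-stable : ∀ {k} (φ : Fm C k) {ρ} → M (SatX 𝓜 φ ρ) → SatX 𝓜 φ ρ
  SatX-stable (P i t)   m = P-stable m
  SatX-stable (R i s t) m = R-stable m
  SatX-stable (s ≐ t)   m = ≈-stable m
  SatX-stable ⊥'        m = m id
  SatX-stable (φ ⇒ ψ)   m = λ a → SatX-stable ψ (m >>= λ f → return (f a))
  SatX-stable (∀' φ)    m = λ a → SatX-stable φ (m >>= λ f → return (f a))

module _ (N : ℕ) where

  InRange : ∀ {C : Set} {k} → Fm C k → Set
  InRange (P i t)   = i ≤ N
  -- Strict, because an edge of index i ends at level i + 1, which must not exceed N.
  InRange (R i s t) = i < N
  InRange (s ≐ t)   = ⊤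
  InRange ⊥'        = ⊤
  InRange (φ ⇒ ψ)   = InRange φ × InRange ψ
  InRange (∀' φ)    = InRange φ

  -- A move extends a position by an element together with its ancestors.
  cost : ∀ {C : Set} {k} → Fm C k → ℕ
  cost (φ ⇒ ψ) = cost φ + cost ψ
  cost (∀' φ)  = suc N + cost φ
  cost _       = 0

-- Counting up to K, types of nodes and the game

module Game {C : Set} (𝓜 : XModel C) (forest : Forest 𝓜) (N K : ℕ) where
  open XModel 𝓜
  open Classical B
  open Forest forest
  open Types K

  ≈-absurd : ∀ {x y} → B → x ≈ y
  ≈-absurd b = ≈-stable λ _ → b

  P-absurd : ∀ {i x} → B → Pˣ i x
  P-absurd b = P-stable λ _ → b

  R-absurd : ∀ {i x y} → B → Rˣ i x y
  R-absurd b = R-stable λ _ → b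

  same-level : ∀ {i j x} → Pˣ i x → Pˣ j x → M (i ≡ j)
  same-level {i} {j} p q with i ≟ j
  ... | yes e = return e
  ... | no ¬e = absurd (disjoint ¬e p q)

  Distinct : ∀ {n} → (Fin n → Dom) → Set
  Distinct ys = ∀ a b → ys a ≈ ys b → M (a ≡ b)

  Among : ∀ {n} → Dom → (Fin n → Dom) → Set
  Among y zs = ∃ λ b → y ≈ zs b

  Outside : ∀ {n} → Dom → (Fin n → Dom) → Set
  Outside y zs = ∀ b → y ≈ zs b → B

  decide-among : ∀ {n} y (zs : Fin n → Dom) → M (Among y zs ⊎ Outside y zs)
  decide-among y zs = em (Among y zs) >>= λ
    { (inj₁ a) → return (inj₁ a)
    ; (inj₂ o) → return (inj₂ λ b e → o (b , e)) }

  Distinct-∷ : ∀ {n y} {zs : Fin n → Dom} → Outside y zs → Distinct zs → Distinct (y ∷ zs)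
  Distinct-∷ o d zero    zero    e = return refl
  Distinct-∷ o d zero    (suc b) e = absurd (o b e)
  Distinct-∷ o d (suc a) zero    e = absurd (o a (≈-sym e))
  Distinct-∷ o d (suc a) (suc b) e = d a b e >>= λ q → return (cong suc q)

  pigeonhole : ∀ {m n} {ys : Fin m → Dom} {zs : Fin n → Dom} → n < m → Distinct ys →
    (∀ a → M (Among (ys a) zs)) → B
  pigeonhole {m} {ys = ys} {zs} n<m d H = choice m H λ f →
    let a , b , a<b , q = Fin.pigeonhole n<m (λ c → proj₁ (f c)) in
    d a b (≈-trans (proj₂ (f a)) (subst (λ c → zs c ≈ ys b) (sym q) (≈-sym (proj₂ (f b)))))
      λ e → ⊥-elim (Fin.<⇒≢ a<b e)

  pick-outside : ∀ {m n} {ys : Fin m → Dom} {zs : Fin n → Dom} → n < m → Distinct ys →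
    M (∃ λ a → Outside (ys a) zs)
  pick-outside n<m d k = pigeonhole n<m d λ a k' → k (a , λ b e → k' (b , e))

  -- Exactly j elements up to equality if j < K, at least K if j = K: the witnesses have to exhaust
  -- Q only below the truncation.
  Count : ℕ → (Dom → Set) → Set
  Count j Q = M (∃ λ (ys : Fin j → Dom) → Distinct ys × (∀ a → Q (ys a)) ×
    (j < K → ∀ y → Q y → M (Among y ys)))

  Count-map : ∀ {j Q Q'} → (∀ {y} → Q y → Q' y) → (∀ {y} → Q' y → Q y) → Count j Q → Count j Q'
  Count-map to from c = c >>= λ { (ys , d , q , cov) →
    return (ys , d , (λ a → to (q a)) , λ j<K y q' → cov j<K y (from q')) }

  Count-< : ∀ {j j' Q} → j < j' → j' ≤ K → Count j Q → Count j' Q → B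
  Count-< j<j' j'≤K c c' = c λ { (ys , d , q , cov) → c' λ { (ys' , d' , q' , _) →
    pigeonhole j<j' d' λ a → cov (≤-trans j<j' j'≤K) (ys' a) (q' a) } }

  Count-unique : ∀ {j j' Q} → j ≤ K → j' ≤ K → Count j Q → Count j' Q → M (j ≡ j')
  Count-unique {j} {j'} j≤K j'≤K c c' with <-cmp j j'
  ... | tri< j<j' _ _ = absurd (Count-< j<j' j'≤K c c')
  ... | tri≈ _ j≡j' _ = return j≡j'
  ... | tri> _ _ j'<j = absurd (Count-< j'<j j≤K c' c)

  Count-exists : ∀ Q → M (∃ λ j → j ≤ K × Count j Q)
  Count-exists Q = grow K 0 (+-identityʳ K) (λ ()) (λ ()) (λ ())
    where
    grow : ∀ f m → f + m ≡ K → (ys : Fin m → Dom) → Distinct ys → (∀ a → Q (ys a)) →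
      M (∃ λ j → j ≤ K × Count j Q)
    grow zero m refl ys d q = return (m , ≤-refl , return (ys , d , q , λ m<m → ⊥-elim (<-irrefl refl m<m)))
    grow (suc f) m e ys d q = em (∃ λ y → Q y × Outside y ys) >>= λ
      { (inj₁ (y , qy , o)) → grow f (suc m) (trans (+-suc f m) e) (y ∷ ys) (Distinct-∷ o d)
          λ { zero → qy ; (suc a) → q a }
      ; (inj₂ none) → return (m , subst (m ≤_) e (m≤n+m m (suc f)) ,
          return (ys , d , q , λ _ y qy k → none (y , qy , λ b e → k (b , e)))) }

  Type : ∀ d → ℕ → Fin (types d) → Dom → Set
  Type zero    l t x = ⊤
  Type (suc d) l t x = ∀ s → Count (count d t s) (λ y → Rˣ l x y × Type d (suc l) s y)

  Type-stable : ∀ d {l t x} → M (Type d l t x) → Type d l t x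
  Type-stable zero    m = tt
  Type-stable (suc d) m s = m >>= λ T → T s

  Type-cong : ∀ d {l t x x'} → x ≈ x' → Type d l t x → Type d l t x'
  Type-cong zero    e T = tt
  Type-cong (suc d) e T s = Count-map (λ { (r , q) → R-cong e ≈-refl r , q })
    (λ { (r , q) → R-cong (≈-sym e) ≈-refl r , q }) (T s)

  Type-unique : ∀ d {l t t' x} → Type d l t x → Type d l t' x → M (t ≡ t')
  Type-unique zero {t = zero} {t' = zero} T T' = return refl
  Type-unique (suc d) {l} {t} {t'} T T' =
    choice (types d) (λ s → Count-unique (count≤K d t s) (count≤K d t' s) (T s) (T' s)) >>= λ H →
    return (count-injective d t t' H)

  Type-exists : ∀ d l x → M (∃ λ t → Type d l t x)
  Type-exists zero    l x = return (zero , tt)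
  Type-exists (suc d) l x =
    choice (types d) (λ s → Count-exists (λ y → Rˣ l x y × Type d (suc l) s y)) >>= λ H →
    let t , e = fromCounts d (λ s → proj₁ (H s)) (λ s → proj₁ (proj₂ (H s))) in
    return (t , λ s → subst (λ j → Count j _) (sym (e s)) (proj₂ (proj₂ (H s))))

  -- The Ehrenfeucht–Fraïssé game

  -- One half of a position. Types control what lies below a listed node, `closed` lists everything
  -- above it; so the edges joining a new node to listed ones are determined by its parent.
  record Preserves {n} (ρ ρ' : Fin n → Dom) : Set where
    field
      ≈-pres : ∀ a b → ρ a ≈ ρ b → ρ' a ≈ ρ' b
      P-pres : ∀ a {i} → i ≤ N → Pˣ i (ρ a) → Pˣ i (ρ' a)
      R-pres : ∀ a b {i} → i < N → Rˣ i (ρ a) (ρ b) → Rˣ i (ρ' a) (ρ' b)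
      T-pres : ∀ a {d l t} → d + l ≡ N → Pˣ l (ρ a) → Type d l t (ρ a) → Type d l t (ρ' a)
      closed : ∀ a {l} → l < N → Pˣ (suc l) (ρ a) → M (∃ λ b → Rˣ l (ρ b) (ρ a))
  open Preserves

  Position : ∀ {n} → (Fin n → Dom) → (Fin n → Dom) → Set
  Position ρ ρ' = Preserves ρ ρ' × Preserves ρ' ρ

  record Match {n} (ρ ρ' : Fin n → Dom) (x x' : Dom) : Set where
    field
      fresh    : Outside x ρ
      P-match  : ∀ {i} → i ≤ N → Pˣ i x → Pˣ i x'
      T-match  : ∀ {d l t} → d + l ≡ N → Pˣ l x → Type d l t x → Type d l t x'
      R-match  : ∀ a {i} → i < N → Rˣ i (ρ a) x → Rˣ i (ρ' a) x'
      ancestor : ∀ {l} → l < N → Pˣ (suc l) x → M (∃ λ b → Rˣ l (ρ b) x)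
  open Match

  extend-Preserves : ∀ {n} {ρ ρ' : Fin n → Dom} {x x'} → Preserves ρ ρ' → Match ρ ρ' x x' →
    Preserves (x ∷ ρ) (x' ∷ ρ')
  extend-Preserves {ρ = ρ} {ρ'} {x} {x'} g m = record
    { ≈-pres = eq
    ; P-pres = λ { zero → P-match m ; (suc a) → P-pres g a }
    ; R-pres = rel
    ; T-pres = λ { zero → T-match m ; (suc a) → T-pres g a }
    ; closed = λ { zero l<N p → ancestor m l<N p >>= λ { (b , r) → return (suc b , r) }
                 ; (suc a) l<N p → closed g a l<N p >>= λ { (b , r) → return (suc b , r) } }
    }
    where
    eq : ∀ a b → (x ∷ ρ) a ≈ (x ∷ ρ) b → (x' ∷ ρ') a ≈ (x' ∷ ρ') b
    eq zero    zero    e = ≈-refl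
    eq zero    (suc b) e = ≈-absurd (fresh m b e)
    eq (suc a) zero    e = ≈-absurd (fresh m a (≈-sym e))
    eq (suc a) (suc b) e = ≈-pres g a b e
    rel : ∀ a b {i} → i < N → Rˣ i ((x ∷ ρ) a) ((x ∷ ρ) b) → Rˣ i ((x' ∷ ρ') a) ((x' ∷ ρ') b)
    rel zero    zero    i<N r = R-absurd (disjoint (<⇒≢ ≤-refl) (R-source r) (R-target r))
    -- The new node would be the parent of a listed one; but `closed` lists that parent already, and
    -- parents are unique.
    rel zero    (suc b) i<N r = R-absurd (closed g b i<N (R-target r) λ { (c , r') → fresh m c (unique r r') })
    rel (suc a) zero    i<N r = R-match m a i<N r
    rel (suc a) (suc b) i<N r = R-pres g a b i<N r

  extend : ∀ {n} {ρ ρ' : Fin n → Dom} {x x'} → Position ρ ρ' → Match ρ ρ' x x' → Match ρ' ρ x' x →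
    Position (x ∷ ρ) (x' ∷ ρ')
  extend (g , g') m m' = extend-Preserves g m , extend-Preserves g' m'

  -- Nodes of level above N are included, since formulas in range cannot see their predicates.
  Unlabelled : Dom → Set
  Unlabelled x = ∀ {i} → i ≤ N → Pˣ i x → B

  match-unlabelled : ∀ {n} {ρ ρ' : Fin n → Dom} {x x'} → Outside x ρ → Unlabelled x → Match ρ ρ' x x'
  match-unlabelled o u = record
    { fresh    = o
    ; P-match  = λ i≤N p → P-absurd (u i≤N p)
    ; T-match  = λ {d} {l} e p _ → Type-stable d (absurd (u (subst (l ≤_) e (m≤n+m l d)) p))
    ; R-match  = λ a i<N r → R-absurd (u i<N (R-target r))
    ; ancestor = λ l<N p → absurd (u l<N p)
    }

  module _ {n} {ρ ρ' : Fin n → Dom} {x x' d l t} (d+l≡N : d + l ≡ N) (o : Outside x ρ)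
    (p : Pˣ l x) (p' : Pˣ l x') (T : Type d l t x) (T' : Type d l t x') where

    private
      T-same : ∀ {d' l' t'} → d' + l' ≡ N → Pˣ l' x → Type d' l' t' x → Type d' l' t' x'
      T-same {d'} {l'} e q U = Type-stable d' (same-level p q >>= λ { refl → go (+-cancelʳ-≡ l d' d (trans e (sym d+l≡N))) U })
        where
        go : ∀ {d' t'} → d' ≡ d → Type d' l t' x → M (Type d' l t' x')
        go refl U = Type-unique d T U >>= λ { refl → return T' }

    match-labelled : (∀ a {i} → i < N → Rˣ i (ρ a) x → Rˣ i (ρ' a) x') →
      (∀ {l'} → l' < N → Pˣ (suc l') x → M (∃ λ b → Rˣ l' (ρ b) x)) → Match ρ ρ' x x'
    match-labelled R-m anc = record
      { fresh    = o
      ; P-match  = λ i≤N q → P-stable (same-level p q >>= λ { refl → return p' })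
      ; T-match  = T-same
      ; R-match  = R-m
      ; ancestor = anc
      }

  match-root : ∀ {n} {ρ ρ' : Fin n → Dom} {x x' t} → Outside x ρ → Pˣ 0 x → Pˣ 0 x' →
    Type N 0 t x → Type N 0 t x' → Match ρ ρ' x x'
  match-root o p p' T T' = match-labelled (+-identityʳ N) o p p' T T'
    (λ a i<N r → R-absurd (disjoint (λ ()) p (R-target r)))
    (λ _ q → absurd (disjoint (λ ()) p q))

  match-child : ∀ {n} {ρ ρ' : Fin n → Dom} {x x' d l t} → Preserves ρ ρ' → d + suc l ≡ N →
    Outside x ρ → ∀ a → Rˣ l (ρ a) x → Rˣ l (ρ' a) x' →
    Type d (suc l) t x → Type d (suc l) t x' → Match ρ ρ' x x'
  match-child g e o a r r' T T' = match-labelled e o (R-target r) (R-target r') T T'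
    (λ b _ q → R-stable (same-level (R-target r) (R-target q) >>= λ { refl →
      return (R-cong (≈-pres g a b (unique r q)) ≈-refl r') }))
    (λ _ q → same-level (R-target r) q >>= λ { refl → return (a , r) })

  -- If all j children of ρ' a of the given type occurred in ρ', then their
  -- partners in ρ together with x would be j + 1 children of ρ a of that type.
  find-child : ∀ {n} {ρ ρ' : Fin n → Dom} {x d l s} → Position ρ ρ' → n < K → d + suc l ≡ N →
    Outside x ρ → ∀ a → Rˣ l (ρ a) x → Type d (suc l) s x →
    M (∃ λ x' → Outside x' ρ' × Rˣ l (ρ' a) x' × Type d (suc l) s x')
  find-child {n} {ρ} {ρ'} {x} {d} {l} {s} (g , g') n<K e o a r T =
    Type-exists (suc d) l (ρ a) >>= λ { (t , U) →
    let U' = T-pres g a {suc d} {l} (trans (sym (+-suc d l)) e) (R-source r) U in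
    U s >>= λ { (ys , _ , _ , cov) →
    U' s >>= λ { (ys' , d' , q' , _) →
    by-size (count d t s <? K) ys ys' cov d' q' } } }
    where
    Child : (Fin n → Dom) → Dom → Set
    Child σ y = Rˣ l (σ a) y × Type d (suc l) s y
    l<N : l < N
    l<N = subst (suc l ≤_) e (m≤n+m (suc l) d)
    by-size : ∀ {j} → Dec (j < K) → (ys ys' : Fin j → Dom) →
      (j < K → ∀ y → Child ρ y → M (Among y ys)) → Distinct ys' → (∀ c → Child ρ' (ys' c)) →
      M (∃ λ x' → Outside x' ρ' × Child ρ' x')
    -- The count is truncated: there are at least K children of this type, more than the n listed
    -- elements.
    by-size (no j≮K) ys ys' cov d' q' =
      pick-outside (<-≤-trans n<K (≮⇒≥ j≮K)) d' >>= λ { (c , o') → return (ys' c , o' , q' c) }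
    by-size {j} (yes j<K) ys ys' cov d' q' k =
      choice j (λ c k' → k (ys' c , (λ b e → k' (b , e)) , q' c)) λ f →
      pigeonhole (n<1+n j) (Distinct-∷ {y = x} {λ c → ρ (proj₁ (f c))} (λ c → o (proj₁ (f c)))
          λ b c e → d' b c (≈-trans (proj₂ (f b)) (≈-trans (≈-pres g _ _ e) (≈-sym (proj₂ (f c))))))
        λ { zero → cov j<K x (r , T)
          ; (suc c) → let r' = R-cong ≈-refl (proj₂ (f c)) (proj₁ (q' c)) in
              cov j<K _ (R-pres g' a (proj₁ (f c)) l<N r' ,
                T-pres g' (proj₁ (f c)) e (R-target r') (Type-cong d (proj₂ (f c)) (proj₂ (q' c)))) }

  -- Q restricts the moves of the responding player; it must be closed under
  -- children and contain K unlabelled nodes and K roots of each type.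
  record Supply (Q : Dom → Set) : Set where
    field
      Q-child     : ∀ {l x y} → Rˣ l x y → Q x → Q y
      blank       : Fin K → Dom
      blank-≉     : Distinct blank
      blank-blank : ∀ a → Unlabelled (blank a)
      blank-Q     : ∀ a → Q (blank a)
      root        : Fin (types N) → Fin K → Dom
      root-≉      : ∀ t → Distinct (root t)
      root-P      : ∀ t a → Pˣ 0 (root t a)
      root-T      : ∀ t a → Type N 0 t (root t a)
      root-Q      : ∀ t a → Q (root t a)

  module Moves (Q : Dom → Set) (supply : Supply Q) where
    open Supply supply

    record Extension {n} (ρ ρ' : Fin n → Dom) (m : ℕ) (x : Dom) : Set where
      field
        {size}   : ℕ
        σ σ'     : Fin size → Dom
        position : Position σ σ'
        bounded  : size ≤ m + n
        ι        : Fin n → Fin size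
        σ-ι      : ∀ a → σ (ι a) ≡ ρ a
        σ'-ι     : ∀ a → σ' (ι a) ≡ ρ' a
        σ'-Q     : ∀ a → Q (σ' a)
        at-x     : Among x σ
    open Extension

    stay : ∀ {n m} {ρ ρ' : Fin n → Dom} {x} → Position ρ ρ' → (∀ a → Q (ρ' a)) → Among x ρ →
      Extension ρ ρ' m x
    stay {m = m} {ρ} {ρ'} g q i = record
      { σ = ρ ; σ' = ρ' ; position = g ; bounded = m≤n+m _ m ; ι = id
      ; σ-ι = λ _ → refl ; σ'-ι = λ _ → refl ; σ'-Q = q ; at-x = i }

    add-to : ∀ {n m} {ρ ρ' : Fin n → Dom} {y x} (X : Extension ρ ρ' m y) {x'} → Q x' →
      Match (σ X) (σ' X) x x' → Match (σ' X) (σ X) x' x → Extension ρ ρ' (suc m) x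
    add-to {x = x} X {x'} q m m' = record
      { σ = x ∷ σ X ; σ' = x' ∷ σ' X ; position = extend (position X) m m' ; bounded = s≤s (bounded X)
      ; ι = suc ∘ ι X ; σ-ι = σ-ι X ; σ'-ι = σ'-ι X
      ; σ'-Q = λ { zero → q ; (suc a) → σ'-Q X a } ; at-x = zero , ≈-refl }

    weaken : ∀ {n m m'} {ρ ρ' : Fin n → Dom} {x} → m ≤ m' → Extension ρ ρ' m x → Extension ρ ρ' m' x
    weaken {n} m≤m' X = record
      { Extension X hiding (bounded) ; bounded = ≤-trans (bounded X) (+-monoˡ-≤ n m≤m') }

    retarget : ∀ {n m} {ρ ρ' : Fin n → Dom} {y x} (X : Extension ρ ρ' m y) → Among x (σ X) →
      Extension ρ ρ' (suc m) x
    retarget X i = record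
      { Extension X hiding (bounded; at-x) ; bounded = ≤-trans (bounded X) (n≤1+n _) ; at-x = i }

    module _ {n} {ρ ρ' : Fin n → Dom} (g : Position ρ ρ') (q : ∀ a → Q (ρ' a)) where

      add : ∀ {x x'} → Q x' → Match ρ ρ' x x' → Match ρ' ρ x' x → Extension ρ ρ' 1 x
      add {x} {x'} q' m m' = record
        { σ = x ∷ ρ ; σ' = x' ∷ ρ' ; position = extend g m m' ; bounded = ≤-refl
        ; ι = suc ; σ-ι = λ _ → refl ; σ'-ι = λ _ → refl
        ; σ'-Q = λ { zero → q' ; (suc a) → q a } ; at-x = zero , ≈-refl }

      forth-unlabelled : ∀ {x} → n < K → Unlabelled x → M (Extension ρ ρ' 1 x)
      forth-unlabelled {x} n<K u = decide-among x ρ >>= λ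
        { (inj₁ i) → return (stay g q i)
        ; (inj₂ o) → pick-outside {zs = ρ'} n<K blank-≉ >>= λ { (a , o') →
            return (add (blank-Q a) (match-unlabelled o u) (match-unlabelled o' (blank-blank a))) } }

      forth-root : ∀ {x} → n < K → Pˣ 0 x → M (Extension ρ ρ' 1 x)
      forth-root {x} n<K p = decide-among x ρ >>= λ
        { (inj₁ i) → return (stay g q i)
        ; (inj₂ o) → Type-exists N 0 x >>= λ { (t , T) →
            pick-outside {zs = ρ'} n<K (root-≉ t) >>= λ { (a , o') →
            return (add (root-Q t a) (match-root o p (root-P t a) T (root-T t a))
              (match-root o' (root-P t a) p (root-T t a) T)) } } }

      -- The parent is answered first, so that `find-child` can answer x among the children of the
      -- parent's partner. Hence level l costs at most l + 1 new elements.
      forth-level : ∀ l {x} → l ≤ N → l + n < K → Pˣ l x → M (Extension ρ ρ' (suc l) x)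
      forth-level zero    l≤N l+n<K p = forth-root l+n<K p
      forth-level (suc l) {x} l<N l+n<K p = parent p >>= λ { (z , r) →
        forth-level l (≤-trans (n≤1+n l) l<N) (≤-trans (n≤1+n _) l+n<K) (R-source r) >>= λ X →
        decide-among x (σ X) >>= λ
        { (inj₁ i) → return (retarget X i)
        ; (inj₂ o) → let a , e = at-x X
                         d = N ∸ suc l
                         r₁ = R-cong e ≈-refl r in
            Type-exists d (suc l) x >>= λ { (s , T) →
            find-child (position X) (≤-trans (s≤s (bounded X)) l+n<K) (m∸n+n≡m l<N) o a r₁ T >>= λ
            { (x' , o' , r' , T') → return (add-to X (Q-child r' (σ'-Q X a))
                (match-child (proj₁ (position X)) (m∸n+n≡m l<N) o a r₁ r' T T')
                (match-child (proj₂ (position X)) (m∸n+n≡m l<N) o' a r' r₁ T' T)) } } } }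

      forth : ∀ x → suc N + n ≤ K → M (Extension ρ ρ' (suc N) x)
      forth x N+n<K = em (∃ λ l → l ≤ N × Pˣ l x) >>= λ
        { (inj₁ (l , l≤N , p)) →
            forth-level l l≤N (≤-trans (s≤s (+-monoˡ-≤ n l≤N)) N+n<K) p >>= λ X →
            return (weaken (s≤s l≤N) X)
        ; (inj₂ none) →
            forth-unlabelled {x} (≤-trans (s≤s (m≤n+m n N)) N+n<K) (λ l≤N p → none (_ , l≤N , p)) >>= λ X →
            return (weaken (s≤s z≤n) X) }


  Link : ∀ {n} → (Fin n → Dom) → (Fin n → Dom) → Dom → Dom → Set
  Link ρ ρ' x x' = ∃ λ a → x ≈ ρ a × x' ≈ ρ' a

  -- In `transfer` the two sides are exchanged at implications and quantifiers, so a restriction on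
  -- one side could not be maintained; it concerns the first answer only.
  unrestricted : ∀ {Q} → Supply Q → Supply (λ _ → ⊤)
  unrestricted supply = record
    { Supply supply hiding (Q-child; blank-Q; root-Q)
    ; Q-child = λ _ _ → tt ; blank-Q = λ _ → tt ; root-Q = λ _ _ → tt }

  module _ {Q : Dom → Set} (supply : Supply Q) (E : C → Set) where
    open Moves (λ _ → ⊤) (unrestricted supply)
    open Extension

    link-term : ∀ {n k} {ρ ρ' : Fin n → Dom} {v v' : Fin k → Dom} (t : Tm C k) → OnT E t →
      (∀ {c} → E c → Link ρ ρ' (cˣ c) (cˣ c)) → (∀ x → Link ρ ρ' (v x) (v' x)) →
      Link ρ ρ' (evalX 𝓜 t v) (evalX 𝓜 t v')
    link-term (var x) o lc lv = lv x
    link-term (con c) o lc lv = lc o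

    transfer : ∀ {n k} {ρ ρ' : Fin n → Dom} {v v' : Fin k → Dom} (φ : Fm C k) →
      Position ρ ρ' → cost N φ + n ≤ K → InRange N φ → OnF E φ →
      (∀ {c} → E c → Link ρ ρ' (cˣ c) (cˣ c)) → (∀ x → Link ρ ρ' (v x) (v' x)) →
      SatX 𝓜 φ v → SatX 𝓜 φ v'
    transfer (P i t) (g , _) b r o lc lv p =
      let a , e , e' = link-term t o lc lv in
      P-cong (≈-sym e') (P-pres g a r (P-cong e p))
    transfer (R i s t) (g , _) b r (o₁ , o₂) lc lv p =
      let a₁ , e₁ , e₁' = link-term s o₁ lc lv
          a₂ , e₂ , e₂' = link-term t o₂ lc lv in
      R-cong (≈-sym e₁') (≈-sym e₂') (R-pres g a₁ a₂ r (R-cong e₁ e₂ p))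
    transfer (s ≐ t) (g , _) b r (o₁ , o₂) lc lv p =
      let a₁ , e₁ , e₁' = link-term s o₁ lc lv
          a₂ , e₂ , e₂' = link-term t o₂ lc lv in
      ≈-trans e₁' (≈-trans (≈-pres g a₁ a₂ (≈-trans (≈-sym e₁) (≈-trans p e₂))) (≈-sym e₂'))
    transfer ⊥' g b r o lc lv p = p
    transfer {n} (φ ⇒ ψ) g b (r₁ , r₂) (o₁ , o₂) lc lv f p =
      transfer ψ g (≤-trans (+-monoˡ-≤ n (m≤n+m (cost N ψ) (cost N φ))) b) r₂ o₂ lc lv (f
        (transfer φ (swap g) (≤-trans (+-monoˡ-≤ n (m≤m+n (cost N φ) (cost N ψ))) b) r₁ o₁
          (λ e → flip (lc e)) (λ x → flip (lv x)) p))
      where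
      flip : ∀ {ρ ρ' : Fin n → Dom} {x x'} → Link ρ ρ' x x' → Link ρ' ρ x' x
      flip (a , e , e') = a , e' , e
    transfer {n} {k} {ρ} {ρ'} {v} {v'} (∀' φ) g b r o lc lv f x' = SatX-stable 𝓜 φ
      -- The challenge x' lies on the side of `v'`; its answer is sought on the side of `v`, where
      -- the universal hypothesis f can be applied.
      (forth (swap g) (λ _ → tt) x' (≤-trans (+-monoˡ-≤ n (m≤m+n (suc N) (cost N φ))) b) >>= λ X →
       let lift : ∀ {y y'} → Link ρ ρ' y y' → Link (σ' X) (σ X) y y'
           lift (a , e , e') = ι X a , subst (_ ≈_) (sym (σ'-ι X a)) e , subst (_ ≈_) (sym (σ-ι X a)) e'
           i , e = at-x X
       in return (transfer φ (swap (position X)) (budget (bounded X)) r o (λ c → lift (lc c))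
            (λ { zero → i , ≈-refl , e ; (suc x) → lift (lv x) }) (f (σ' X i))))
      where
      budget : ∀ {m} → m ≤ suc N + n → cost N φ + m ≤ K
      budget {m} m≤ = ≤-trans (+-monoʳ-≤ (cost N φ) m≤) (≤-trans (≤-reflexive
        (trans (sym (+-assoc (cost N φ) (suc N) n)) (cong (_+ n) (+-comm (cost N φ) (suc N))))) b)

-- Finite sets and finite forests

Finite : Set → Set
Finite A = ∃ λ n → A ↔ Fin n

Finite-⊎ : ∀ {A B : Set} → Finite A → Finite B → Finite (A ⊎ B)
Finite-⊎ (m , I) (n , J) = m + n , ↔-trans (I ⊎-↔ J) (↔-sym Fin.+↔⊎)

Σ-suc↔⊎ : ∀ {n} {B : Fin (suc n) → Set} → Σ (Fin (suc n)) B ↔ (B zero ⊎ Σ (Fin n) (B ∘ suc))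
Σ-suc↔⊎ = mk↔ₛ′
  (λ { (zero , b) → inj₁ b ; (suc a , b) → inj₂ (a , b) })
  (λ { (inj₁ b) → zero , b ; (inj₂ (a , b)) → suc a , b })
  (λ { (inj₁ b) → refl ; (inj₂ (a , b)) → refl })
  (λ { (zero , b) → refl ; (suc a , b) → refl })

Finite-Σ-Fin : ∀ n {B : Fin n → Set} → (∀ a → Finite (B a)) → Finite (Σ (Fin n) B)
Finite-Σ-Fin zero    F = 0 , mk↔ₛ′ proj₁ (λ ()) (λ ()) (λ { (() , _) })
Finite-Σ-Fin (suc n) F =
  let m , I = Finite-⊎ (F zero) (Finite-Σ-Fin n (F ∘ suc)) in m , ↔-trans Σ-suc↔⊎ I

Finite-Σ : ∀ {A : Set} {B : A → Set} → Finite A → (∀ a → Finite (B a)) → Finite (Σ A B)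
Finite-Σ (n , I) F =
  let m , J = Finite-Σ-Fin n (λ k → F (Inverse.from I k)) in
  m , ↔-trans (↔-sym (Σ-↔ (↔-sym I) ↔-refl)) J

Finite-splits : ∀ N → Finite (∃ λ l → ∃ λ d → l + d ≡ N)
Finite-splits N = suc N , mk↔ₛ′ to from
    (λ k → trans (Fin.fromℕ<-cong _ _ refl _ (Fin.toℕ<n k)) (Fin.fromℕ<-toℕ k (Fin.toℕ<n k)))
    (λ { (l , d , e) → unique (Fin.toℕ-fromℕ< _) })
  where
  Split : Set
  Split = ∃ λ l → ∃ λ d → l + d ≡ N
  to : Split → Fin (suc N)
  to (l , d , e) = fromℕ< {l} (s≤s (subst (l ≤_) e (m≤m+n l d)))
  from : Fin (suc N) → Split
  from k = toℕ k , N ∸ toℕ k , m+[n∸m]≡n (≤-pred (Fin.toℕ<n k))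
  unique : ∀ {p q : Split} → proj₁ p ≡ proj₁ q → p ≡ q
  unique {l , d , e} {_ , d' , e'} refl with +-cancelˡ-≡ l d d' (trans e (sym e'))
  ... | refl = cong (λ u → l , d , u) (≡-irrelevant e e')

does-true : ∀ {A : Set} (A? : Dec A) → does A? ≡ true → A
does-true (yes a) _ = a

-- `par` is total, but its value matters only at positive levels. Edges are read off from it, which
-- builds in the uniqueness of parents.
record FiniteForest : Set₁ where
  field
    Node   : Set
    finite : Finite Node
    level  : Node → Maybe ℕ
    par    : Node → Node
    level-par : ∀ v {k} → level v ≡ just (suc k) → level (par v) ≡ just k

  order : ℕ
  order = proj₁ finite

  open Inverse (proj₂ finite) using () renaming (to to encode; from to decode)

  encode-decode : ∀ a → encode (decode a) ≡ a
  encode-decode = Inverse.strictlyInverseˡ (proj₂ finite)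

  decode-encode : ∀ u → decode (encode u) ≡ u
  decode-encode = Inverse.strictlyInverseʳ (proj₂ finite)

  AtLevel : ℕ → Node → Set
  AtLevel k u = level u ≡ just k

  Edge : ℕ → Node → Node → Set
  Edge k u v = AtLevel k u × AtLevel (suc k) v × u ≡ par v

  node≟ : (u v : Node) → Dec (u ≡ v)
  node≟ u v = map′ (λ e → trans (sym (decode-encode u)) (trans (cong decode e) (decode-encode v)))
    (cong encode) (encode u Fin.≟ encode v)

  atLevel? : ∀ k u → Dec (AtLevel k u)
  atLevel? k u = Maybe.≡-dec _≟_ (level u) (just k)

  edge? : ∀ k u v → Dec (Edge k u v)
  edge? k u v = atLevel? k u ×-dec atLevel? (suc k) v ×-dec node≟ u (par v)

  finStr : FinStr order
  finStr = record
    { Pb = λ k a → does (atLevel? k (decode a))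
    ; Rb = λ k a b → does (edge? k (decode a) (decode b)) }

  finStr-model : IsModelT₀ finStr
  finStr-model _ (disj i j i≢j) a h = h λ p q → i≢j (Maybe.just-injective
    (trans (sym (does-true (atLevel? i _) p)) (does-true (atLevel? j _) q)))
  finStr-model _ (typ i) a b r h = let p , q , _ = does-true (edge? i _ _) r in
    h (dec-true (atLevel? i _) p) (dec-true (atLevel? (suc i) _) q)
  finStr-model _ (pred i) a p h = h (encode v) λ k → k
      (dec-true (atLevel? i _) at) (dec-true (edge? i _ _) (at , does-true (atLevel? (suc i) _) p , decode-encode v))
    where
    v = par (decode a)
    at : AtLevel i (decode (encode v))
    at = trans (cong level (decode-encode v)) (level-par _ (does-true (atLevel? (suc i) _) p))
  finStr-model _ (uniq i) a a' b h = decidable-stable (a Fin.≟ a') λ a≢a' → h λ r r' →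
    a≢a' (trans (sym (encode-decode a)) (trans (cong encode (trans
      (proj₂ (proj₂ (does-true (edge? i _ _) r))) (sym (proj₂ (proj₂ (does-true (edge? i _ _) r'))))))
      (encode-decode a')))

-- The disjoint union of one tree for every type of root, and an unlabelled node

module Universal (N K : ℕ) where
  open Types K

  -- A node is the path leading to it: a root type, then at each step a child type and the number of
  -- a sibling of that type. The type of the parent says how many such siblings there are, hence the
  -- joint definition with `type`.
  NodeAt : ℕ → ℕ → Set
  type : ∀ l d → NodeAt l d → Fin (types d)

  NodeAt zero    d = Fin (types d)
  NodeAt (suc l) d = Σ (NodeAt l (suc d)) λ u → Σ (Fin (types d)) λ s → Fin (count d (type l (suc d) u) s)

  type zero    d t           = t
  type (suc l) d (u , s , i) = s

  Finite-NodeAt : ∀ l d → Finite (NodeAt l d)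
  Finite-NodeAt zero    d = types d , ↔-refl
  Finite-NodeAt (suc l) d = Finite-Σ (Finite-NodeAt l (suc d)) λ u →
    Finite-Σ-Fin (types d) λ s → count d (type l (suc d) u) s , ↔-refl

  UNode : Set
  UNode = ⊤ ⊎ Σ (∃ λ l → ∃ λ d → l + d ≡ N) λ { (l , d , _) → NodeAt l d }

  -- Unfolding this bijection makes type checking infeasible.
  abstract
    Finite-UNode : Finite UNode
    Finite-UNode = Finite-⊎ (1 , ↔-sym Fin.1↔⊤)
      (Finite-Σ (Finite-splits N) λ { (l , d , _) → Finite-NodeAt l d })

  universal : FiniteForest
  universal = record
    { Node   = UNode
    ; finite = Finite-UNode
    ; level  = level
    ; par    = par
    ; level-par = λ { (inj₂ ((suc l , d , e) , _)) refl → refl }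
    }
    where
    level : UNode → Maybe ℕ
    level (inj₁ _)             = nothing
    level (inj₂ ((l , _) , _)) = just l
    par : UNode → UNode
    par (inj₂ ((suc l , d , e) , u , _)) = inj₂ ((l , suc d , trans (+-suc l d) e) , u)
    par u                                = u

record Copy (E : Enumeration) (F : FiniteForest) : Set where
  open FiniteForest F
  field
    position  : ℕ
    place     : Node → Fin (size E position)
    place-inj : ∀ {u v} → place u ≡ place v → u ≡ v
    place-sur : ∀ b → ∃ λ u → place u ≡ b
    place-P   : ∀ {k u} → AtLevel k u → Pb (str E position) k (place u) ≡ true
    place-¬P  : ∀ {k u} → ¬ AtLevel k u → Pb (str E position) k (place u) ≡ false
    place-R   : ∀ {k u v} → Edge k u v → Rb (str E position) k (place u) (place v) ≡ true
    place-R⁻¹ : ∀ {k u v} → Rb (str E position) k (place u) (place v) ≡ true → Edge k u v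

-- The node `u₀` shows that the forest is nonempty, as `complete` covers only structures with at
-- least one element.
copy : (E : Enumeration) (F : FiniteForest) → FiniteForest.Node F → Copy E F
copy E F u₀ with complete E (FiniteForest.order F) (≤-trans (s≤s z≤n) (Fin.toℕ<n (Inverse.to (proj₂ (FiniteForest.finite F)) u₀)))
                   (FiniteForest.finStr F) (FiniteForest.finStr-model F)
... | i , f , f-P , f-R = record
  { position  = i
  ; place     = λ u → Inverse.to f (encode u)
  ; place-inj = λ {u} {v} e → trans (sym (decode-encode u)) (trans (cong decode (injective e)) (decode-encode v))
  ; place-sur = λ b → decode (Inverse.from f b) ,
      trans (cong (Inverse.to f) (encode-decode _)) (Inverse.strictlyInverseˡ f b)
  ; place-P   = λ {k} {u} p → trans (P-copy k u) (dec-true (atLevel? k u) p)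
  ; place-¬P  = λ {k} {u} ¬p → trans (P-copy k u) (dec-false (atLevel? k u) ¬p)
  ; place-R   = λ {k} {u} {v} r → trans (R-copy k u v) (dec-true (edge? k u v) r)
  ; place-R⁻¹ = λ {k} {u} {v} t → does-true (edge? k u v) (trans (sym (R-copy k u v)) t)
  }
  where
  open FiniteForest F
  open Inverse (proj₂ finite) using () renaming (to to encode; from to decode)
  injective : ∀ {a b} → Inverse.to f a ≡ Inverse.to f b → a ≡ b
  injective e = trans (sym (Inverse.strictlyInverseʳ f _)) (trans (cong (Inverse.from f) e) (Inverse.strictlyInverseʳ f _))
  P-copy : ∀ k u → Pb (str E i) k (Inverse.to f (encode u)) ≡ does (atLevel? k u)
  P-copy k u = trans (f-P k (encode u)) (cong (λ v → does (atLevel? k v)) (decode-encode u))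
  R-copy : ∀ k u v → Rb (str E i) k (Inverse.to f (encode u)) (Inverse.to f (encode v)) ≡ does (edge? k u v)
  R-copy k u v = trans (f-R k (encode u) (encode v))
      (cong₂ (λ u v → does (edge? k u v)) (decode-encode u) (decode-encode v))

-- Exploding models of T and the constants in them

module _ {C : Set} (𝓜 : XModel C) where
  open XModel 𝓜
  open Classical B

  ⋁-elim : ∀ {k} n (f : Fin n → Fm C k) {ρ} → SatX 𝓜 (⋁ n f) ρ → M (∃ λ a → SatX 𝓜 (f a) ρ)
  ⋁-elim zero    f b = absurd b
  ⋁-elim (suc n) f {ρ} s = em (SatX 𝓜 (f zero) ρ) >>= λ
    { (inj₁ t) → return (zero , t)
    ; (inj₂ ¬t) → ⋁-elim n (f ∘ suc) (s ¬t) >>= λ { (a , t) → return (suc a , t) } }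

  ⋁-intro : ∀ {k} n (f : Fin n → Fm C k) {ρ} a → SatX 𝓜 (f a) ρ → SatX 𝓜 (⋁ n f) ρ
  ⋁-intro (suc n) f zero    s = λ ¬s → SatX-stable 𝓜 (⋁ n _) (absurd (¬s s))
  ⋁-intro (suc n) f (suc a) s = λ _ → ⋁-intro n (f ∘ suc) a s

module ModelOfT (E : Enumeration) (𝓜 : XModel (Const E)) (valid : ∀ {σ} → T E σ → 𝓜 ⊨ˣ σ) where
  open XModel 𝓜
  open Classical B

  forest : Forest 𝓜
  forest = record
    { disjoint = λ i≢j p q → valid (ax₀ (disj _ _ i≢j)) _ λ k → k p q
    ; R-source = λ r → P-stable λ k → valid (ax₀ (typ _)) _ _ r λ p q → k p
    ; R-target = λ r → P-stable λ k → valid (ax₀ (typ _)) _ _ r λ p q → k q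
    ; parent   = λ p k → valid (ax₀ (pred _)) _ p λ y h → h λ _ r → k (y , r)
    ; unique   = λ r r' → valid (ax₀ (uniq _)) _ _ _ λ k → k r r'
    }

  const-≉ : ∀ {c d} → c ≢ d → cˣ c ≈ cˣ d → B
  const-≉ c≢d = valid (dist _ _ c≢d)

  const-P : ∀ {i j k a} → Pb (str E i) k a ≡ true → Pˣ k (cˣ (i , j , a))
  const-P e = valid (P⁺ _ _ _ _ e)

  const-¬P : ∀ {i j k a} → Pb (str E i) k a ≡ false → Pˣ k (cˣ (i , j , a)) → B
  const-¬P e = valid (P⁻ _ _ _ _ e)

  const-R : ∀ {i j k a b} → Rb (str E i) k a b ≡ true → Rˣ k (cˣ (i , j , a)) (cˣ (i , j , b))
  const-R e = valid (R⁺ _ _ _ _ _ e)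

  const-R⁻¹ : ∀ {i j k a b} → Rˣ k (cˣ (i , j , a)) (cˣ (i , j , b)) → M (Rb (str E i) k a b ≡ true)
  const-R⁻¹ {i} {j} {k} {a} {b} r = by _ refl
    where
    by : ∀ t → Rb (str E i) k a b ≡ t → M (Rb (str E i) k a b ≡ true)
    by true  e = return e
    by false e = absurd (valid (R⁻ i j k a b e) r)

  closure : ∀ {i j k a x y} → x ≈ cˣ (i , j , a) → Rˣ k x y ⊎ Rˣ k y x → M (∃ λ b → y ≈ cˣ (i , j , b))
  closure {i} {j} {k} {a} {x} {y} e r = ⋁-elim 𝓜 (size E i) _ (valid (clos i j k) x y λ h →
    h (⋁-intro 𝓜 (size E i) (λ a → x₁ ≐ cst E i j a) a e) (edge r))
    where
    edge : Rˣ k x y ⊎ Rˣ k y x → (Rˣ k x y → B) → Rˣ k y x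
    edge (inj₁ r) ¬r = R-stable λ _ → ¬r r
    edge (inj₂ r) ¬r = r

  module Realisation (N K : ℕ) (universe : Copy E (Universal.universal N K)) where
    open Types K
    open Universal N K
    open Copy universe
    open Game 𝓜 forest N K

    node : ∀ {l d} → l + d ≡ N → NodeAt l d → UNode
    node e u = inj₂ ((_ , _ , e) , u)

    point : ℕ → UNode → Const E
    point j u = position , j , place u

    point-inj : ∀ {j u v} → point j u ≡ point j v → u ≡ v
    point-inj refl' = place-inj (second refl')
      where
      second : ∀ {j} {a b : Fin (size E position)} → _≡_ {A = Const E} (position , j , a) (position , j , b) → a ≡ b
      second refl = refl

    node-inj : ∀ {l d d' e e' u w} → node {l} {d} e u ≡ node {l} {d'} e' w →
      Σ (d ≡ d') λ q → subst (NodeAt l) q u ≡ w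
    node-inj refl = refl , refl

    -- The prescribed children exist by the diagram. There are no others: `closure` keeps every
    -- child inside the copy, the diagram makes it a child in the universal forest, and uniqueness
    -- of types forces it to be one of the listed nodes.
    realised : ∀ d l (e : l + d ≡ N) j (u : NodeAt l d) → Type d l (type l d u) (cˣ (point j (node e u)))
    realised zero    l e j u = tt
    realised (suc d) l e j u s = return (ys , distinct , child , λ _ y → cover)
      where
      e' : suc l + d ≡ N
      e' = trans (sym (+-suc l d)) e
      kid : Fin (count d (type l (suc d) u) s) → UNode
      kid c = node {suc l} e' (u , s , c)
      ys : Fin (count d (type l (suc d) u) s) → Dom
      ys c = cˣ (point j (kid c))
      distinct : Distinct ys
      distinct a b q with a Fin.≟ b
      ... | yes a≡b = return a≡b
      ... | no a≢b = absurd (const-≉ (λ p → a≢b (kid-inj (point-inj {j} {kid a} {kid b} p))) q)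
        where
        kid-inj : kid a ≡ kid b → a ≡ b
        kid-inj refl = refl
      child : ∀ c → Rˣ l (cˣ (point j (node e u))) (ys c) × Type d (suc l) s (ys c)
      child c = const-R (place-R {l} {node e u} {kid c}
          (refl , refl , cong (λ q → node q u) (≡-irrelevant e _))) ,
        realised d (suc l) e' j (u , s , c)
      cover-node : ∀ {y} v → FiniteForest.Edge universal l (node e u) v → y ≈ cˣ (point j v) →
        Type d (suc l) s y → M (Among y ys)
      cover-node (inj₂ ((suc l , d' , e'') , w , s' , c)) (refl , refl , par) q S
        with node-inj par
      ... | refl , refl = Type-unique d (Type-cong d q S) (realised d (suc l) e'' j (u , s' , c)) >>= λ
        { refl → return (c , subst (λ p → _ ≈ cˣ (point j (node {suc l} p (u , s , c)))) (≡-irrelevant e'' e') q) }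
      cover : ∀ {y} → Rˣ l (cˣ (point j (node e u))) y × Type d (suc l) s y → M (Among y ys)
      cover {y} (r , S) = closure ≈-refl (inj₁ r) >>= λ { (b , q) → by-place b q (place-sur b) }
        where
        by-place : ∀ b → y ≈ cˣ (position , j , b) → ∃ (λ v → place v ≡ b) → M (Among y ys)
        by-place b q (v , refl) = const-R⁻¹ (R-cong ≈-refl q r) >>= λ t →
          cover-node v (place-R⁻¹ {l} {node e u} {v} t) q S

-- Substitution in exploding models and soundness

module _ {C : Set} (𝓜 : XModel C) where
  open XModel 𝓜
  open Classical B

  evalX-bind : ∀ {k l} {v : Fin k → Tm C l} {ρ ρ'} → (∀ x → evalX 𝓜 (v x) ρ ≈ ρ' x) →
    ∀ t → evalX 𝓜 (bindT con v t) ρ ≈ evalX 𝓜 t ρ'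
  evalX-bind e (var x) = e x
  evalX-bind e (con c) = ≈-refl

  SatX-bind : ∀ {k l} {v : Fin k → Tm C l} {ρ ρ'} → (∀ x → evalX 𝓜 (v x) ρ ≈ ρ' x) →
    ∀ φ → (SatX 𝓜 (bindF con v φ) ρ → SatX 𝓜 φ ρ') × (SatX 𝓜 φ ρ' → SatX 𝓜 (bindF con v φ) ρ)
  SatX-bind e (P i t) = P-cong (evalX-bind e t) , P-cong (≈-sym (evalX-bind e t))
  SatX-bind e (R i s t) = R-cong (evalX-bind e s) (evalX-bind e t) ,
    R-cong (≈-sym (evalX-bind e s)) (≈-sym (evalX-bind e t))
  SatX-bind e (s ≐ t) =
    (λ p → ≈-trans (≈-sym (evalX-bind e s)) (≈-trans p (evalX-bind e t))) ,
    (λ p → ≈-trans (evalX-bind e s) (≈-trans p (≈-sym (evalX-bind e t))))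
  SatX-bind e ⊥' = id , id
  SatX-bind e (φ ⇒ ψ) =
    let to , from = SatX-bind e φ ; to' , from' = SatX-bind e ψ in
    (λ f p → to' (f (from p))) , (λ f p → from' (f (to p)))
  SatX-bind {v = v} {ρ} {ρ'} e (∀' φ) = (λ f a → proj₁ (under a) (f a)) , (λ f a → proj₂ (under a) (f a))
    where
    shift : ∀ a t → evalX 𝓜 (renT suc t) (a ∷ ρ) ≡ evalX 𝓜 t ρ
    shift a (var x) = refl
    shift a (con c) = refl
    ext : ∀ a x → evalX 𝓜 (extS v x) (a ∷ ρ) ≈ (a ∷ ρ') x
    ext a zero    = ≈-refl
    ext a (suc x) = subst (_≈ ρ' x) (sym (shift a (v x))) (e x)
    under : ∀ a → _
    under a = SatX-bind {v = extS v} {a ∷ ρ} {a ∷ ρ'} (ext a) φ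

  SatX-inst : ∀ {k} (φ : Fm C (suc k)) t {ρ a} → evalX 𝓜 t ρ ≈ a →
    (SatX 𝓜 (inst φ t) ρ → SatX 𝓜 φ (a ∷ ρ)) × (SatX 𝓜 φ (a ∷ ρ) → SatX 𝓜 (inst φ t) ρ)
  SatX-inst φ t {ρ} {a} e = subst (λ χ → (SatX 𝓜 χ ρ → SatX 𝓜 φ (a ∷ ρ)) × (SatX 𝓜 φ (a ∷ ρ) → SatX 𝓜 χ ρ))
    (sym (inst-bind φ t)) (SatX-bind (λ { zero → e ; (suc x) → ≈-refl }) φ)

  soundness : ∀ {Γ : Fm C 0 → Set} → (∀ {σ} → Γ σ → 𝓜 ⊨ˣ σ) →
    ∀ {k φ} → Der Γ k φ → ∀ ρ → SatX 𝓜 φ ρ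
  soundness H (ax {σ = σ} a) ρ = subst (λ χ → SatX 𝓜 χ ρ) (sym (close-bind σ))
    (proj₂ (SatX-bind (λ ()) σ) (H a))
  soundness H (mp d e) ρ = soundness H d ρ (soundness H e ρ)
  soundness H (gen d) ρ a = soundness H d (a ∷ ρ)
  soundness H (ax-K φ ψ) ρ p q = p
  soundness H (ax-S φ ψ χ) ρ f g p = f p (g p)
  soundness H (ax-DN φ) ρ m = SatX-stable 𝓜 φ m
  soundness H (ax-inst φ t) ρ f = proj₂ (SatX-inst φ t ≈-refl) (f (evalX 𝓜 t ρ))
  soundness H (ax-dist φ ψ) ρ f g a = f a (g a)
  soundness H (ax-vac φ) ρ p a = subst (λ χ → SatX 𝓜 χ (a ∷ ρ)) (sym (renF-bind suc φ))
    (proj₂ (SatX-bind (λ _ → ≈-refl) φ) p)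
  soundness H (ax-refl t) ρ = ≈-refl
  soundness H (ax-leib φ s t) ρ e p = proj₂ (SatX-inst φ t (≈-sym e)) (proj₁ (SatX-inst φ s ≈-refl) p)

module _ (E : Enumeration) where

  _≟ᶜ_ : (c d : Const E) → Dec (c ≡ d)
  _≟ᶜ_ = Product.≡-dec _≟_ (Product.≡-dec _≟_ Fin._≟_)

  countableConst : Countable (Const E)
  countableConst = (λ n → decode (unpair n)) , λ { (i , j , a) →
      pair i (pair j (toℕ a)) , trans (cong decode (unpair-pair i _))
        (trans (cong (λ p → i , proj₁ p , element i (proj₂ p)) (unpair-pair j (toℕ a)))
          (cong (λ b → i , j , b) (element-toℕ i a))) }
    where
    element : ∀ i → ℕ → Fin (size E i)
    element i m with m <? size E i
    ... | yes m<n = fromℕ< m<n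
    ... | no  _   = fromℕ< (nonempty E i)
    element-toℕ : ∀ i a → element i (toℕ a) ≡ a
    element-toℕ i a with toℕ a <? size E i
    ... | yes p = Fin.fromℕ<-toℕ a p
    ... | no ¬p = ⊥-elim (¬p (Fin.toℕ<n a))
    decode : ℕ × ℕ → Const E
    decode (i , m) = i , proj₁ (unpair m) , element i (proj₂ (unpair m))

  -- Consistency

  -- Edges stay inside one copy, which is what the closure axioms demand. All atoms of the resulting
  -- model are decidable, so it is stable with B empty.
  data Rᶜ (k : ℕ) : Const E → Const E → Set where
    rel : ∀ {i j a b} → Rb (str E i) k a b ≡ true → Rᶜ k (i , j , a) (i , j , b)

  Pᶜ : ℕ → Const E → Set
  Pᶜ k (i , j , a) = Pb (str E i) k a ≡ true

  Rᶜ-stable : ∀ {k x y} → ¬ ¬ Rᶜ k x y → Rᶜ k x y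
  Rᶜ-stable {k} {i , j , a} {i' , j' , b} ¬¬r with i ≟ i' | j ≟ j'
  ... | yes refl | yes refl = rel (decidable-stable (Rb (str E i) k a b Bool.≟ true)
        λ ¬e → ¬¬r λ { (rel e) → ¬e e })
  ... | no i≢i'  | _        = ⊥-elim (¬¬r λ { (rel _) → i≢i' refl })
  ... | _        | no j≢j'  = ⊥-elim (¬¬r λ { (rel _) → j≢j' refl })

  standard : XModel (Const E)
  standard = record
    { B   = ⊥
    ; Dom = Const E
    ; _≈_ = _≡_
    ; Pˣ  = Pᶜ
    ; Rˣ  = Rᶜ
    ; cˣ  = id
    ; ≈-refl   = refl
    ; ≈-sym    = sym
    ; ≈-trans  = trans
    ; P-cong   = λ { refl p → p }
    ; R-cong   = λ { refl refl r → r }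
    ; ≈-stable = λ {x} {y} → decidable-stable (x ≟ᶜ y)
    ; P-stable = λ {k} {x} → decidable-stable (Pb (str E (proj₁ x)) k (proj₂ (proj₂ x)) Bool.≟ true)
    ; R-stable = Rᶜ-stable
    }

  standard-T : ∀ {σ} → T E σ → standard ⊨ˣ σ
  standard-T (ax₀ (disj k l k≢l)) (i , j , a) = model E i _ (disj k l k≢l) a
  standard-T (ax₀ (typ k)) _ _ (rel {i} {j} {a} {b} r) = model E i _ (typ k) a b r
  standard-T (ax₀ (pred k)) (i , j , a) p h = model E i _ (pred k) a p λ b h' →
    h (i , j , b) λ f → h' λ q r → f q (rel r)
  standard-T (ax₀ (uniq k)) x y z h = decidable-stable (x ≟ᶜ y) λ x≢y → h λ r r' → x≢y (same r r')
    where
    same : ∀ {x y z} → Rᶜ k x z → Rᶜ k y z → x ≡ y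
    same (rel {i} {j} {a} {c} r) (rel {a = b} r') =
      cong (λ u → i , j , u) (model E i _ (uniq k) a b c λ f → f r r')
  standard-T (dist c d c≢d) = c≢d
  standard-T (eq⁺ i j a b a≡b) = cong (λ u → i , j , u) a≡b
  standard-T (eq⁻ i j a b a≢b) refl = a≢b refl
  standard-T (P⁺ i j k a e) = e
  standard-T (P⁻ i j k a e) e' with () ← trans (sym e) e'
  standard-T (R⁺ i j k a b e) = rel e
  standard-T (R⁻ i j k a b e) (rel e') with () ← trans (sym e) e'
  standard-T (clos i j k) x y h = SatX-stable standard (⋁ (size E i) _) λ ¬s → h λ s s' →
    ⋁-elim standard (size E i) (λ a → x₁ ≐ cst E i j a) s λ { (a , e) →
    em (Rᶜ k x y) λ { (inj₁ r) → ¬s (in-block e (inj₁ r)) ; (inj₂ ¬r) → ¬s (in-block e (inj₂ (s' ¬r))) } }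
    where
    open Classical ⊥
    in-block : ∀ {x y a} → x ≡ (i , j , a) → Rᶜ k x y ⊎ Rᶜ k y x →
      SatX standard (⋁ (size E i) (λ a → x₀ ≐ cst E i j a)) (y ∷ (x ∷ λ ()))
    in-block refl (inj₁ (rel {b = b} _)) = ⋁-intro standard (size E i) _ b refl
    in-block refl (inj₂ (rel {a = b} _)) = ⋁-intro standard (size E i) _ b refl

  consistent : ¬ (T E ⊢ ⊥')
  consistent d = soundness standard standard-T d (λ ())

-- Levels and constants of a formula

InRange-mono : ∀ {N N'} → N ≤ N' → ∀ {C : Set} {k} (φ : Fm C k) → InRange N φ → InRange N' φ
InRange-mono le (P i t)   r = ≤-trans r le
InRange-mono le (R i s t) r = ≤-trans r le
InRange-mono le (s ≐ t)   r = tt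
InRange-mono le ⊥'        r = tt
InRange-mono le (φ ⇒ ψ)   (r , r') = InRange-mono le φ r , InRange-mono le ψ r'
InRange-mono le (∀' φ)    r = InRange-mono le φ r

range : ∀ {C : Set} {k} (φ : Fm C k) → ∃ λ N → InRange N φ
range (P i t)   = i , ≤-refl
range (R i s t) = suc i , ≤-refl
range (s ≐ t)   = 0 , tt
range ⊥'        = 0 , tt
range (φ ⇒ ψ)   =
  let m , p = range φ ; n , q = range ψ in
  m + n , InRange-mono (m≤m+n m n) φ p , InRange-mono (m≤n+m n m) ψ q
range (∀' φ)    = range φ

module _ {C : Set} where

  constantsT : ∀ {k} → Tm C k → List C
  constantsT (var x) = []
  constantsT (con c) = c List.∷ []

  constants : ∀ {k} → Fm C k → List C
  constants (P i t)   = constantsT t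
  constants (R i s t) = constantsT s ++ constantsT t
  constants (s ≐ t)   = constantsT s ++ constantsT t
  constants ⊥'        = []
  constants (φ ⇒ ψ)   = constants φ ++ constants ψ
  constants (∀' φ)    = constants φ

  OnT-constants : ∀ {k} {cs : List C} (t : Tm C k) → (∀ {c} → c ∈ constantsT t → c ∈ cs) → OnT (_∈ cs) t
  OnT-constants (var x) H = tt
  OnT-constants (con c) H = H (here refl)

  OnF-constants : ∀ {k} {cs : List C} (φ : Fm C k) → (∀ {c} → c ∈ constants φ → c ∈ cs) → OnF (_∈ cs) φ
  OnF-constants (P i t)   H = OnT-constants t H
  OnF-constants (R i s t) H = OnT-constants s (H ∘ ∈-++⁺ˡ) , OnT-constants t (H ∘ ∈-++⁺ʳ (constantsT s))
  OnF-constants (s ≐ t)   H = OnT-constants s (H ∘ ∈-++⁺ˡ) , OnT-constants t (H ∘ ∈-++⁺ʳ (constantsT s))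
  OnF-constants ⊥'        H = tt
  OnF-constants (φ ⇒ ψ)   H = OnF-constants φ (H ∘ ∈-++⁺ˡ) , OnF-constants ψ (H ∘ ∈-++⁺ʳ (constants φ))
  OnF-constants (∀' φ)    H = OnF-constants φ H

module _ (E : Enumeration) where

  block : Const E → List (Const E)
  block (i , j , _) = map (λ a → i , j , a) (allFin (size E i))

  blocks : List (Const E) → List (Const E)
  blocks = concatMap block

  ∈-blocks : ∀ {i j a b cs} → (i , j , a) ∈ cs → (i , j , b) ∈ blocks cs
  ∈-blocks {b = b} m = ∈-concatMap⁺ block (Any.map (λ { refl → ∈-map⁺ _ (∈-allFin b) }) m)

  blocks-closed : ∀ {i j a b cs} → (i , j , a) ∈ blocks cs → (i , j , b) ∈ blocks cs
  blocks-closed {b = b} {cs} m = ∈-concatMap⁺ block (Any.map (λ {c} → swap-block {c = c}) (∈-concatMap⁻ block {cs} m))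
    where
    swap-block : ∀ {i j a b c} → (i , j , a) ∈ block c → (i , j , b) ∈ block c
    swap-block {b = b} m with ∈-map⁻ _ m
    ... | _ , _ , refl = ∈-map⁺ _ (∈-allFin b)

-- Finitely many representative constants

module Representatives (E : Enumeration) (ψ : Fm (Const E) 1) where

  N : ℕ
  N = proj₁ (range ψ)

  -- Whole copies are taken, not just the constants of ψ, because the starting position has to
  -- contain the parents of its members.
  base : List (Const E)
  base = blocks E (constants ψ)

  -- The starting position has `length base` elements, the first move adds at most N + 1, and the
  -- rest of the game on ψ at most `cost N ψ`.
  K : ℕ
  K = cost N ψ + (suc N + length base)

  universe : Copy E (Universal.universal N K)
  universe = copy E (Universal.universal N K) (inj₁ tt)

  open Copy universe using (position; place; place-P; place-¬P)

  origin : ℕ → Const E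
  origin j = position , j , place (inj₁ tt)

  -- Each of the K copies of the universal forest supplies one unlabelled node and one root of each
  -- type.
  representatives : List (Const E)
  representatives = blocks E (constants ψ ++ map origin (upTo K))

  module _ (𝓜 : XModel (Const E)) (valid : ∀ {σ} → T E σ → 𝓜 ⊨ˣ σ) where
    open XModel 𝓜
    open Classical B
    open ModelOfT E 𝓜 valid
    open Realisation N K universe
    open Game 𝓜 forest N K
    open Universal N K using (UNode)

    Near : List (Const E) → Dom → Set
    Near cs x = M (∃ λ c → c ∈ cs × x ≈ cˣ c)

    Near-closed : ∀ {cs k x y} → Near (blocks E cs) x → Rˣ k x y ⊎ Rˣ k y x → Near (blocks E cs) y
    Near-closed {cs} near r = near >>= λ { (c , m , e) → closure e r >>= λ { (b , e') →
      return (_ , blocks-closed E {cs = cs} m , e') } }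

    near-point : ∀ (a : Fin K) u → Near representatives (cˣ (point (toℕ a) u))
    near-point a u = return (_ , ∈-blocks E (∈-++⁺ʳ (constants ψ) (∈-map⁺ origin (∈-upTo⁺ (Fin.toℕ<n a)))) , ≈-refl)

    distinct-copies : ∀ u → Distinct {K} (λ a → cˣ (point (toℕ a) u))
    distinct-copies u a b e with a Fin.≟ b
    ... | yes a≡b = return a≡b
    ... | no a≢b = absurd (const-≉ (λ q → a≢b (Fin.toℕ-injective (cong (proj₁ ∘ proj₂) q))) e)

    supply : Supply (Near representatives)
    supply = record
      { Q-child     = λ r near → Near-closed {constants ψ ++ map origin (upTo K)} near (inj₁ r)
      ; blank       = λ a → cˣ (point (toℕ a) (inj₁ tt))
      ; blank-≉     = distinct-copies (inj₁ tt)
      ; blank-blank = λ a _ → const-¬P (place-¬P λ ())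
      ; blank-Q     = λ a → near-point a (inj₁ tt)
      ; root        = λ t a → cˣ (point (toℕ a) (node {0} refl t))
      ; root-≉      = λ t → distinct-copies (node {0} refl t)
      ; root-P      = λ t a → const-P (place-P refl)
      ; root-T      = λ t a → realised N 0 refl (toℕ a) t
      ; root-Q      = λ t a → near-point a (node {0} refl t)
      }

    ρ₀ : Fin (length base) → Dom
    ρ₀ a = cˣ (lookup base a)

    at-base : ∀ {c} → c ∈ base → Among (cˣ c) ρ₀
    at-base m = Any.index m , subst (λ c → cˣ _ ≈ cˣ c) (lookup-index m) ≈-refl

    start : Preserves ρ₀ ρ₀
    start = record
      { ≈-pres = λ _ _ → id
      ; P-pres = λ _ _ → id
      ; R-pres = λ _ _ _ → id
      ; T-pres = λ _ _ _ → id
      -- The parent of a constant lies in the same copy by the closure axioms, and `base` is a union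
      -- of copies.
      ; closed = λ a _ p → Forest.parent forest p >>= λ { (z , r) →
          Near-closed {constants ψ} (return (_ , ∈-lookup {xs = base} a , ≈-refl)) (inj₂ r) >>= λ { (c , m , e) →
          let b , e' = at-base m in return (b , R-cong (≈-trans e e') ≈-refl r) } }
      }

    open Moves (Near representatives) supply
    open Extension

    base-near : ∀ a → Near representatives (ρ₀ a)
    base-near a = return (_ , ∈-concatMap⁺ (block E) (++⁺ˡ (∈-concatMap⁻ (block E) {constants ψ} (∈-lookup {xs = base} a))) , ≈-refl)

    represented : ∀ y → M (∃ λ c → c ∈ representatives ×
      (SatX 𝓜 ψ (cˣ c ∷ λ ()) → SatX 𝓜 ψ (y ∷ λ ())))
    represented y = forth (start , start) base-near y (m≤n+m _ (cost N ψ)) >>= λ X →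
      let i , e = at-x X in
      σ'-Q X i >>= λ { (c , m , e') → return (c , m ,
        -- The position is swapped because truth has to pass from the answer, which equals c, back
        -- to the challenge y.
        transfer supply (_∈ base) ψ (swap (position X)) (+-monoʳ-≤ (cost N ψ) (bounded X)) (proj₂ (range ψ))
          (OnF-constants ψ (λ m' → ∈-blocks E m'))
          (λ m' → let a , e'' = at-base m' in ι X a , subst (_ ≈_) (sym (σ'-ι X a)) e'' , subst (_ ≈_) (sym (σ-ι X a)) e'')
          (λ { zero → i , ≈-sym e' , e })) }

-- Deciding every sentence

module _ (E : Enumeration) where

  generalise : (ψ : Fm (Const E) 1) →
    (∀ c → c ∈ Representatives.representatives E ψ → T E ⊢ inst ψ (con c)) → T E ⊢ ∀' ψ
  generalise ψ H = completeness (countableConst E) (T E) (∀' ψ) λ 𝓜 valid y →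
    SatX-stable 𝓜 ψ {y ∷ λ ()} λ k → Representatives.represented E ψ 𝓜 (valid ∘ ax₀') y λ { (c , m , f) →
      k (f (proj₁ (SatX-inst 𝓜 ψ (con c) (XModel.≈-refl 𝓜)) (valid (H c m)))) }

  all-or-counterexample : ∀ {A B : Const E → Set} → (∀ c → A c ⊎ B c) → ∀ cs → (∀ c → c ∈ cs → A c) ⊎ ∃ B
  all-or-counterexample f []       = inj₁ λ _ ()
  all-or-counterexample f (c List.∷ cs) with f c | all-or-counterexample f cs
  ... | inj₂ b | _       = inj₂ (c , b)
  ... | inj₁ _ | inj₂ b  = inj₂ b
  ... | inj₁ a | inj₁ as = inj₁ λ { _ (here refl) → a ; d (there m) → as d m }

  Decided : Fm (Const E) 0 → Set
  Decided φ = (T E ⊢ φ) ⊎ (T E ⊢ ¬' φ)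

  decide-P : ∀ k c → Decided (P k (con c))
  decide-P k (i , j , a) with Pb (str E i) k a in e
  ... | true  = inj₁ (ax₀' (P⁺ i j k a e))
  ... | false = inj₂ (ax₀' (P⁻ i j k a e))

  decide-≐ : ∀ c d → Decided (con c ≐ con d)
  decide-≐ c d with _≟ᶜ_ E c d
  ... | yes refl = inj₁ (ax-refl _)
  ... | no c≢d   = inj₂ (ax₀' (dist c d c≢d))

  -- The diagram says nothing about constants from different copies; there an edge would put the
  -- second constant into the copy of the first by the closure axioms, against distinctness.
  decide-R : ∀ k c d → Decided (R k (con c) (con d))
  decide-R k (i , j , a) (i' , j' , b) with i ≟ i' | j ≟ j'
  ... | no i≢i' | _ = inj₂ (completeness (countableConst E) (T E) _ λ 𝓜 valid r →
          let open ModelOfT E 𝓜 (valid ∘ ax₀') in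
          closure (XModel.≈-refl 𝓜) (inj₁ r) λ { (_ , e) → const-≉ (λ { refl → i≢i' refl }) e })
  ... | yes refl | no j≢j' = inj₂ (completeness (countableConst E) (T E) _ λ 𝓜 valid r →
          let open ModelOfT E 𝓜 (valid ∘ ax₀') in
          closure (XModel.≈-refl 𝓜) (inj₁ r) λ { (_ , e) → const-≉ (λ { refl → j≢j' refl }) e })
  ... | yes refl | yes refl with Rb (str E i) k a b in e
  ...   | true  = inj₁ (ax₀' (R⁺ i j k a b e))
  ...   | false = inj₂ (ax₀' (R⁻ i j k a b e))

  closedT : ∀ {k} (ρ : Fin k → Const E) (t : Tm (Const E) k) → ∃ λ c → bindT con (con ∘ ρ) t ≡ con {k = 0} c
  closedT ρ (var x) = ρ x , refl
  closedT ρ (con c) = c , refl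

  -- Open formulas with constants for their variables are decided, so that the instances of a
  -- quantified formula are reached by structural recursion.
  decide : ∀ {k} (φ : Fm (Const E) k) (ρ : Fin k → Const E) → Decided (bindF con (con ∘ ρ) φ)
  decide (P i t) ρ with closedT ρ t
  ... | c , e rewrite e = decide-P i c
  decide (R i s t) ρ with closedT ρ s | closedT ρ t
  ... | c , e | d , e' rewrite e | e' = decide-R i c d
  decide (s ≐ t) ρ with closedT ρ s | closedT ρ t
  ... | c , e | d , e' rewrite e | e' = decide-≐ c d
  decide ⊥' ρ = inj₂ (⇒-refl _)
  decide (φ ⇒ ψ) ρ with decide φ ρ | decide ψ ρ
  ... | _       | inj₁ q  = inj₁ (const q)
  ... | inj₂ ¬p | inj₂ _  = inj₁ (⇒-trans ¬p ⊥-elim')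
  ... | inj₁ p  | inj₂ ¬q = inj₂ (⇒-trans (ap (⇒-refl _) (const p)) ¬q)
  decide {k} (∀' φ) ρ with all-or-counterexample instances (Representatives.representatives E ψ)
    where
    ψ : Fm (Const E) 1
    ψ = bindF con (extS (con ∘ ρ)) φ
    inst-ψ : ∀ c → bindF con (con ∘ (c ∷ ρ)) φ ≡ inst ψ (con c)
    inst-ψ c = sym (trans (inst-bind ψ (con c)) (trans (bindF-∘ con _ con (extS (con ∘ ρ)) φ)
      (bindF-cong (λ _ → refl) (λ { zero → refl ; (suc x) → refl }) φ)))
    instances : ∀ c → Decided (inst ψ (con c))
    instances c = subst Decided (inst-ψ c) (decide φ (c ∷ ρ))
  ... | inj₁ all      = inj₁ (generalise _ all)
  ... | inj₂ (c , ¬p) = inj₂ (⇒-trans (ax-inst _ (con c)) ¬p)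

theorem5p14 : (E : Enumeration) → Complete (T E)
theorem5p14 E = consistent E , λ φ →
  subst (Decided E) (trans (bindF-cong (λ _ → refl) (λ ()) φ) (bindF-id φ)) (decide E φ (λ ()))
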